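{- Let $M$ be an $L$-structure and $\phi(x,y)$ an $L$-formula. Let $\epsilon>0$ and suppose $\phi(x,y)$ is $\epsilon$-stable in $M$. Fix $\gamma>\delta>0$ and let $p\in S_{\phi(x)}(M)$. Then there is a $\phi^*(y)$-formula $\psi(y)$ over $M$ such that $$\sup_{b\in M^y}\mathfrak d(\psi^M(b),\phi(p,b))\leq2\epsilon+\gamma.$$ Moreover, $\psi(y)$ is $\operatorname{diam}_M(\phi)/\delta$-Lipschitz as a function on the metric space $S_{\phi^*(y)}(M)$.
   Context: Logic: We work in continuous (metric) first-order logic with values in $\mathfrak V=\ell^\infty(\omega)$ (real Banach space), with metric $\mathfrak d(\mathfrak r,\mathfrak s)=\|\mathfrak r-\mathfrak s\|_\infty$; an isometric copy $\mathbb R\hookrightarrow\mathfrak V$ is fixed. It is set up as standard $[0,1]$-valued continuous logic (complete metric structures, possibly many-sorted, symbols with prescribed moduli of uniform continuity), except that each predicate symbol $P$ of the language $L$ comes with a compact set $K_P\subseteq\mathfrak V$ in which it takes values; connectives are all continuous functions $u:\mathfrak V^n\to\mathfrak V$; and $\sup_x\psi$, $\inf_x\psi$ are formed only for formulas $\psi$ with value set $K_\psi\subseteq\mathbb R^{\geq0}$. Inductively each formula $\phi$ has a compact value set $K_\phi\subseteq\mathfrak V$ ($K_{u(\phi_0,\ldots,\phi_{n-1})}=u(\prod_i K_{\phi_i})$, and $K_{\sup_x\psi}=K_{\inf_x\psi}=K_\psi$), and $\phi^M$ takes values in $K_\phi$ in every $L$-structure $M$. Here $x,y$ are tuples of variables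 and $M^x$ is the product of sorts of $M$ corresponding to $x$. $N\succeq M$ means $N$ is an elementary extension of $M$. $\operatorname{diam}_M(\phi)=\sup\{\mathfrak d(\phi^M(a,b),\phi^M(a',b')):a,a'\in M^x,\ b,b'\in M^y\}$. Types: $\phi^*(y,x)$ is the formula $\phi(x,y)$ with the roles of object and parameter variables swapped. $S_{\phi(x)}(M)$ is the set of complete $\phi(x)$-types over $M$. A type $p\in S_{\phi(x)}(M)$ is determined by the function $b\mapsto\phi(p,b)$ from $M^y$ to $K_\phi$, where $\phi(p,b)=\phi^N(a,b)$ for any realization $a\in N^x$ of $p$ in some $N\succeq M$. Likewise, $S_{\phi^*(y)}(M)$ is the set of complete $\phi^*(y)$-types over $M$, a type $q$ being determined by $a\mapsto\phi^*(q,a)$, $a\in M^x$; its metric is $d(q,q')=\sup_{a\in M^x}\mathfrak d(\phi^*(q,a),\phi^*(q',a))$. A $\phi^*(y)$-formula over $M$ is a formula of the form $u(\phi(a_0,y),\ldots,\phi(a_{n-1},y))$ with $a_i\in M^x$ and $u:\mathfrak V^n\to\mathfrak V$ continuous; it is evaluated on $q\in S_{\phi^*(y)}(M)$ by $u(\phi^*(q,a_0),\ldots,\phi^*(q,a_{n-1}))$. Stability: $\phi(x,y)$ is $\epsilon$-stable in $M$ if there are no sequences $\langle a_i\rangle_{i<\omega}$ in $M^x$ and $\langle b_i\rangle_{i<\omega}$ in $M^y$ such that $\mathfrak d(\phi^M(a_i,b_j),\phi^M(a_j,b_i))\geq\epsilon$ for all $i<j<\omega$. -}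

module Defs where

open import Level using (Level; suc)
open import Algebra.Bundles using (CommutativeRing)
open import Data.Fin.Base using (Fin)
open import Data.List.Base using (List; []; _∷_; _++_)
open import Data.List.Membership.Propositional using (_∈_)
open import Data.List.Relation.Unary.All as All using (All; []; _∷_)
open import Data.List.Relation.Unary.All.Properties using (++⁺)
open import Data.List.Relation.Unary.Any using (Any)
open import Data.Nat.Base as ℕ using (ℕ)
open import Data.Product.Base using (Σ; ∃; _×_)
open import Data.Vec.Functional using (Vector)
open import Function.Base using (_∘_; flip)
open import Function.Metric.Structures using (IsGeneralMetric)
open import Relation.Binary.Bundles using (TotalOrder)
open import Relation.Binary.Core using (Rel)
open import Relation.Binary.Definitions using (_Respects_)
open import Relation.Binary.Structures using (IsTotalOrder)
open import Relation.Nullary.Negation using (¬_)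
open import Relation.Unary using (Pred; Satisfiable; _⊆_)
import Algebra.Construct.NaturalChoice.Max as Max
import Relation.Binary.Construct.NonStrictToStrict as Strict

------------------------------------------------------------------------
-- The real numbers

-- ℝ is axiomatised, up to isomorphism, as a Dedekind complete ordered
-- field.  The operations _⁻¹ and sup are total; their values are
-- unspecified at 0# and on sets that are empty or unbounded above.

record CompleteOrderedField (ℓ : Level) : Set (suc ℓ) where
  infix 8 _⁻¹
  infixl 7 _/_
  infixl 6 _-_
  infix 4 _≤_
  field
    commutativeRing : CommutativeRing ℓ ℓ

  open CommutativeRing commutativeRing public
    renaming (Carrier to ℝ) using (_≈_; _+_; _*_; -_; 0#; 1#)

  field
    _≤_          : Rel ℝ ℓ
    isTotalOrder : IsTotalOrder _≈_ _≤_
    0≉1          : ¬ 0# ≈ 1#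
    _⁻¹          : ℝ → ℝ
    ⁻¹-inverseʳ  : ∀ {r} → ¬ r ≈ 0# → r * r ⁻¹ ≈ 1#
    +-monoʳ-≤    : ∀ r {s t} → s ≤ t → r + s ≤ r + t
    *-nonneg     : ∀ {r s} → 0# ≤ r → 0# ≤ s → 0# ≤ r * s

  UpperBound : Pred ℝ ℓ → Pred ℝ ℓ
  UpperBound S r = ∀ {s} → S s → s ≤ r

  LowerBound : Pred ℝ ℓ → Pred ℝ ℓ
  LowerBound S r = ∀ {s} → S s → r ≤ s

  field
    sup       : Pred ℝ ℓ → ℝ
    sup-upper : ∀ {S} → Satisfiable S → Satisfiable (UpperBound S) →
                UpperBound S (sup S)
    sup-least : ∀ {S} → Satisfiable S → Satisfiable (UpperBound S) →
                LowerBound (UpperBound S) (sup S)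

  inf : Pred ℝ ℓ → ℝ
  inf S = sup (LowerBound S)

  totalOrder : TotalOrder ℓ ℓ ℓ
  totalOrder = record { isTotalOrder = isTotalOrder }

  open Strict _≈_ _≤_ public using (_<_)

  _-_ _/_ : ℝ → ℝ → ℝ
  r - s = r + (- s)
  r / s = r * s ⁻¹

  2# : ℝ
  2# = 1# + 1#

  ∣_∣ : ℝ → ℝ
  ∣ r ∣ = Max._⊔_ totalOrder r (- r)

------------------------------------------------------------------------
-- The value space ℓ^∞(ω)

module ValueSpace {ℓ} (R : CompleteOrderedField ℓ) where
  open CompleteOrderedField R hiding (_≈_)
  private module R = CompleteOrderedField R

  infix 4 _≈_

  record 𝔙 : Set ℓ where
    field
      coord   : ℕ → ℝ
      bounded : ∃ λ B → ∀ n → ∣ coord n ∣ ≤ B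

  open 𝔙

  _≈_ : Rel 𝔙 ℓ
  v ≈ w = ∀ n → coord v n R.≈ coord w n

  𝔡 : 𝔙 → 𝔙 → ℝ
  𝔡 v w = sup λ r → ∃ λ n → r R.≈ ∣ coord v n - coord w n ∣

  Open : Pred (Pred 𝔙 ℓ) ℓ
  Open U = ∀ v → U v →
    ∃ λ η → 0# < η × (∀ w → 𝔡 v w < η → U w)

  Compact : Pred (Pred 𝔙 ℓ) (suc ℓ)
  Compact K = {I : Set ℓ} (U : I → Pred 𝔙 ℓ) → (∀ i → Open (U i)) →
    (∀ {v} → K v → ∃ λ i → U i v) →
    ∃ λ (is : List I) → ∀ {v} → K v → Any (λ i → U i v) is

  record CompactSet : Set (suc ℓ) where
    field
      member   : Pred 𝔙 ℓ
      respects : member Respects _≈_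
      compact  : Compact member

  Continuous : ∀ {n} → (Vector 𝔙 n → 𝔙) → Set ℓ
  Continuous u = ∀ v ε → 0# < ε → ∃ λ η → 0# < η ×
    (∀ w → (∀ i → 𝔡 (v i) (w i) < η) → 𝔡 (u v) (u w) < ε)

  record IsometricCopy : Set ℓ where
    field
      embed    : ℝ → 𝔙
      isometry : ∀ r s → 𝔡 (embed r) (embed s) R.≈ ∣ r - s ∣

------------------------------------------------------------------------
-- Continuous logic with values in 𝔙, for a fixed copy of ℝ in 𝔙

module ContinuousLogic {ℓ} (R : CompleteOrderedField ℓ)
                       (copy : ValueSpace.IsometricCopy R) where
  open CompleteOrderedField R hiding (_≈_)
  open ValueSpace R
  open CompactSet
  open IsometricCopy copy renaming (embed to ι)
  private module R = CompleteOrderedField R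

  NonNegReal : Pred 𝔙 ℓ
  NonNegReal v = ∃ λ r → 0# ≤ r × v ≈ ι r

  -- The metric of each sort is one of the predicates, and so also comes
  -- with a compact set of values.

  record Language : Set (suc ℓ) where
    field
      Sort        : Set ℓ
      Fun         : List Sort → Sort → Set ℓ
      Pr          : List Sort → Set ℓ
      funModulus  : ∀ {ss s} → Fun ss s → ℝ → ℝ
      funModulus⁺ : ∀ {ss s} (f : Fun ss s) {ε} → 0# < ε → 0# < funModulus f ε
      prModulus   : ∀ {ss} → Pr ss → ℝ → ℝ
      prModulus⁺  : ∀ {ss} (P : Pr ss) {ε} → 0# < ε → 0# < prModulus P ε
      prValues    : ∀ {ss} → Pr ss → CompactSet
      dValues     : Sort → CompactSet
      dValues⁺    : ∀ s → member (dValues s) ⊆ NonNegReal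

  module _ (L : Language) where
    open Language L

    -- A context lists the sorts of the variables in scope.

    data Term (Γ : List Sort) : Sort → Set ℓ where
      var : ∀ {s} → s ∈ Γ → Term Γ s
      app : ∀ {ss s} → Fun ss s → All (Term Γ) ss → Term Γ s

    -- K ψ is the value set K_ψ.

    data Formula (Γ : List Sort) : Set ℓ
    K : ∀ {Γ} → Formula Γ → Pred 𝔙 ℓ

    data Formula Γ where
      pred : ∀ {ss} → Pr ss → All (Term Γ) ss → Formula Γ
      dist : ∀ {s} → Term Γ s → Term Γ s → Formula Γ
      conn : ∀ {n} (u : Vector 𝔙 n → 𝔙) → Continuous u →
             Vector (Formula Γ) n → Formula Γ
      Sup  : ∀ {s} (ψ : Formula (s ∷ Γ)) → K ψ ⊆ NonNegReal → Formula Γ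
      Inf  : ∀ {s} (ψ : Formula (s ∷ Γ)) → K ψ ⊆ NonNegReal → Formula Γ

    K (pred P ts)     = member (prValues P)
    K (dist {s} t t′) = member (dValues s)
    K (conn u _ φs)   = λ v → ∃ λ w → (∀ i → K (φs i) (w i)) × v ≈ u w
    K (Sup ψ _)       = K ψ
    K (Inf ψ _)       = K ψ

    record Structure : Set (suc ℓ) where
      field
        Carrier  : Sort → Set ℓ
        _≈ₛ_     : ∀ {s} → Rel (Carrier s) ℓ
        d        : ∀ {s} → Carrier s → Carrier s → ℝ
        isMetric : ∀ {s} →
                   IsGeneralMetric (_≈ₛ_ {s}) R._≈_ _≤_ 0# _+_ (d {s})
        complete : ∀ {s} (a : ℕ → Carrier s) →
                   (∀ ε → 0# < ε →
                     ∃ λ N → ∀ m n → N ℕ.≤ m → N ℕ.≤ n → d (a m) (a n) < ε) →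
                   ∃ λ b → ∀ ε → 0# < ε →
                     ∃ λ N → ∀ n → N ℕ.≤ n → d (a n) b < ε
        nonempty : ∀ s → Carrier s

      Tuple : List Sort → Set ℓ
      Tuple = All Carrier

      Within : ∀ {ss} → ℝ → Rel (Tuple ss) ℓ
      Within η a b = ∀ {s} (i : s ∈ _) →
        d (All.lookup a i) (All.lookup b i) < η

      field
        fun      : ∀ {ss s} → Fun ss s → Tuple ss → Carrier s
        fun-unif : ∀ {ss s} (f : Fun ss s) {ε} → 0# < ε → ∀ {a b} →
                   Within (funModulus f ε) a b → d (fun f a) (fun f b) ≤ ε
        pr       : ∀ {ss} → Pr ss → Tuple ss → 𝔙
        pr-unif  : ∀ {ss} (P : Pr ss) {ε} → 0# < ε → ∀ {a b} →
                   Within (prModulus P ε) a b → 𝔡 (pr P a) (pr P b) ≤ ε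
        pr-value : ∀ {ss} (P : Pr ss) a → member (prValues P) (pr P a)
        d-value  : ∀ {s} (a b : Carrier s) → member (dValues s) (ι (d a b))

    open Structure using (Tuple)

    module _ (M : Structure) where
      open Structure M hiding (Tuple)

      mutual
        evalTerm : ∀ {Γ s} → Term Γ s → Tuple M Γ → Carrier s
        evalTerm (var i)    e = All.lookup e i
        evalTerm (app f ts) e = fun f (evalTerms ts e)

        evalTerms : ∀ {Γ ss} → All (Term Γ) ss → Tuple M Γ → Tuple M ss
        evalTerms []       e = []
        evalTerms (t ∷ ts) e = evalTerm t e ∷ evalTerms ts e

      -- In the last two clauses the set consists of the values of ψ, read
      -- as real numbers.  It is nonempty and bounded, because these values
      -- lie in K ψ, which is compact and contained in NonNegReal.

      eval : ∀ {Γ} → Formula Γ → Tuple M Γ → 𝔙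
      eval (pred P ts)   e = pr P (evalTerms ts e)
      eval (dist t t′)   e = ι (d (evalTerm t e) (evalTerm t′ e))
      eval (conn u _ φs) e = u (λ i → eval (φs i) e)
      eval (Sup ψ _)     e = ι (sup λ r → ∃ λ a → eval ψ (a ∷ e) ≈ ι r)
      eval (Inf ψ _)     e = ι (inf λ r → ∃ λ a → eval ψ (a ∷ e) ≈ ι r)

  module _ {L : Language} where
    open Language L using (Sort)
    open Structure using (Tuple)

    record _≼_ (M N : Structure L) : Set ℓ where
      field
        map        : ∀ {s} → Structure.Carrier M s → Structure.Carrier N s
        elementary : ∀ {Γ} (ψ : Formula L Γ) (e : Tuple M Γ) →
                     eval L N ψ (All.map map e) ≈ eval L M ψ e

    -- Formulas with their free variables split into object variables x and
    -- parameter variables y, given by their interpretations.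

    Bivariate : List Sort → List Sort → Set (suc ℓ)
    Bivariate x y = (M : Structure L) → Tuple M x → Tuple M y → 𝔙

    ⟦_⟧ : ∀ {x y} → Formula L (x ++ y) → Bivariate x y
    ⟦ φ ⟧ M a b = eval L M φ (++⁺ a b)

    _⋆ : ∀ {x y} → Bivariate x y → Bivariate y x
    (φ ⋆) M = flip (φ M)

    module _ {x y : List Sort} (φ : Bivariate x y) (M : Structure L) where

      -- φ(x)-types over M.  A type p is given by b ↦ φ(p,b), together with
      -- a realization in an elementary extension; two types are equal when
      -- these functions agree.

      record S : Set (suc ℓ) where
        field
          value       : Tuple M y → 𝔙
          N           : Structure L
          M≼N         : M ≼ N
          realization : Tuple N x
          realizes    : ∀ b →
            φ N realization (All.map (_≼_.map M≼N) b) ≈ value b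

      open S using (value)

      typeDist : S → S → ℝ
      typeDist p p′ = sup λ r → ∃ λ b → r R.≈ 𝔡 (value p b) (value p′ b)

      -- φ(x)-formulas u(φ(x,b₀),…,φ(x,bₙ₋₁)) over M.

      record FormulaOver : Set ℓ where
        field
          {arity}    : ℕ
          connective : Vector 𝔙 arity → 𝔙
          continuous : Continuous connective
          parameter  : Vector (Tuple M y) arity

        atPoint : Tuple M x → 𝔙
        atPoint a = connective (λ i → φ M a (parameter i))

        atType : S → 𝔙
        atType p = connective (value p ∘ parameter)

      diam : ℝ
      diam = sup λ r → ∃ λ a → ∃ λ a′ → ∃ λ b → ∃ λ b′ →
        r R.≈ 𝔡 (φ M a b) (φ M a′ b′)

      Stable : ℝ → Set ℓ
      Stable ε = ¬ (Σ (ℕ → Tuple M x) λ a → Σ (ℕ → Tuple M y) λ b →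
        ∀ i j → i ℕ.< j → ε ≤ 𝔡 (φ M (a i) (b j)) (φ M (a j) (b i)))

module Submission where

open import Algebra.Bundles using (CommutativeRing)
open import Axiom.ExcludedMiddle using (ExcludedMiddle)
open import Data.Fin.Base using (Fin; zero; suc)
open import Data.List.Base using (List; []; _∷_; _++_; concat; foldr; lookup; map)
open import Data.List.Membership.Propositional using (_∈_)
open import Data.List.Membership.Propositional.Properties using (∈-++⁺ˡ; ∈-++⁺ʳ)
open import Data.List.Properties using (tabulate-lookup)
open import Data.List.Relation.Binary.Subset.Propositional using () renaming (_⊆_ to _⊑_)
open import Data.List.Relation.Binary.Subset.Propositional.Properties using (∷⁺ʳ; ++⁺ʳ)
open import Data.List.Relation.Unary.All as All using (All; []; _∷_)
open import Data.List.Relation.Unary.All.Properties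
  using (++⁺; ++⁻; lookup-map; map⁻; tabulate⁺)
open import Data.List.Relation.Unary.Any as Any using (Any; here; there)
open import Data.List.Relation.Unary.Any.Properties using (concat⁺; map⁺)
open import Data.Nat.Base as ℕ using (ℕ)
open import Data.Product.Base using (Σ; ∃; _×_; _,_; proj₁; proj₂)
open import Data.Sum.Base using (_⊎_; inj₁; inj₂)
open import Data.Vec.Functional as Vector using (Vector)
open import Function.Base using (_∘_)
open import Relation.Binary.Bundles using (Poset)
open import Relation.Binary.Definitions using (_Respects_)
open import Relation.Binary.PropositionalEquality.Core as ≡ using (_≡_)
open import Relation.Binary.Structures using (IsTotalOrder)
open import Relation.Nullary.Decidable using (yes; no; decidable-stable)
open import Relation.Nullary.Negation using (¬_; contradiction)
open import Relation.Unary using (Pred; Satisfiable; _⊆_)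
import Algebra.Construct.NaturalChoice.Max as Max
import Algebra.Construct.NaturalChoice.Min as Min
import Algebra.Properties.AbelianGroup as AbelianGroupProperties
import Algebra.Properties.CommutativeSemigroup as CommutativeSemigroupProperties
import Algebra.Properties.Ring as RingProperties
import Algebra.Solver.CommutativeMonoid as CommutativeMonoidSolver
import Data.Nat.Properties as ℕ
import Level
import Relation.Binary.Construct.NonStrictToStrict as Strict
import Relation.Binary.Reasoning.PartialOrder as PartialOrderReasoning
import Relation.Binary.Reasoning.Setoid as SetoidReasoning
open import Defs

-- Stability gives finitely many a₀, …, aₙ₋₁ ∈ Mˣ such that φ(p,b) and φ(p,b′) are
-- within 2ε + γ whenever φ(aᵢ,b) and φ(aᵢ,b′) are within δ for all i.  Otherwise one
-- builds aᵢ, bᵢ, bᵢ′ where bⱼ, bⱼ′ is a counterexample for the aᵢ with i < j, and aⱼ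
-- approximates p at bᵢ, bᵢ′ for i < j.  By the triangle inequality, for i < j, the
-- values φ(aᵢ,bⱼ) and φ(aⱼ,bᵢ), or the same with b′ for b, are at least ε apart, and
-- Ramsey's theorem for pairs contradicts stability.
--
-- Thus φ(p,b) is, up to 2ε + γ, a function of the point (φ(aᵢ,b))ᵢ of 𝔙ⁿ, and McShane's
-- formula inf_b (φ(p,b) + (diam φ / δ) d(·, (φ(aᵢ,b))ᵢ)), taken coordinatewise, turns
-- it into a Lipschitz connective.

-- Ordered field

-- The gap between `δ` and `γ` pays for approximation. A realization of `p` lies in an elementary
-- extension, so within `M` it can only be imitated at finitely many tuples, up to an error `η`.
-- Comparing two tuples takes two imitations, and `η = (γ - δ) / 2` gives `δ + 2η = γ`; the summand
-- `2ε` comes from two exchanges of indices, one for `b` and one for `b′`.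
--
-- Imitation has to be expressed by one formula, an infimum over `x`. Quantifiers require
-- nonnegative real values, which is why the formula measures the distance to a fixed vector of
-- values. The total operations `sup` and `inf` are meaningful only on nonempty bounded sets, and
-- this is what compactness of the value sets provides.
--
-- The slope `diam φ / δ` is the least for which the penalty at distance `δ` is sure to outweigh
-- every oscillation of `φ(p,b)`. Distant points then never lower the infimum, and near ones lower
-- it by at most `2ε + γ`. Since the connective is Lipschitz on all of `𝔙ⁿ`, the bound also reaches
-- types that are not realized in `M`.

module RealProperties {ℓ} (em : ExcludedMiddle ℓ) (R : CompleteOrderedField ℓ) where
  open CompleteOrderedField R
  open CommutativeRing commutativeRing public
    hiding (Carrier; _≈_; _+_; _*_; -_; 0#; 1#; _-_; zero)
  open AbelianGroupProperties +-abelianGroup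
    using (xyx⁻¹≈y; ⁻¹-anti-homo‿-; ∙-cancelˡ; \\-leftDividesʳ)
  open CommutativeSemigroupProperties +-commutativeSemigroup public
    using (x∙yz≈y∙xz; x∙yz≈y∙zx; xy∙z≈x∙zy)
  open RingProperties ring using (-‿involutive; -1*x≈-x)
  open Max totalOrder public using (_⊔_; x≤x⊔y; x≤y⊔x; ⊔-lub)
  open Min totalOrder public using (_⊓_; x⊓y≤x; x⊓y≤y; ⊓-sel)

  module ≤ = IsTotalOrder isTotalOrder

  poset : Poset ℓ ℓ ℓ
  poset = record { isPartialOrder = ≤.isPartialOrder }

  module ≤-Reasoning = PartialOrderReasoning poset

  <⇒≱ : ∀ {r s} → r < s → ¬ s ≤ r
  <⇒≱ = Strict.<⇒≱ _≈_ _≤_ ≤.antisym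

  ≰⇒> : ∀ {r s} → ¬ r ≤ s → s < r
  ≰⇒> = Strict.≰⇒> _≈_ _≤_ sym ≤.reflexive ≤.total

  ≮⇒≥ : ∀ {r s} → ¬ r < s → s ≤ r
  ≮⇒≥ = Strict.≮⇒≥ _≈_ _≤_ sym (λ _ _ → em) ≤.reflexive ≤.total

  <-≤-trans : ∀ {r s t} → r < s → s ≤ t → r < t
  <-≤-trans = Strict.<-≤-trans _≈_ _≤_ sym ≤.trans ≤.antisym ≤.≤-respʳ-≈

  ≤-<-trans : ∀ {r s t} → r ≤ s → s < t → r < t
  ≤-<-trans = Strict.≤-<-trans _≈_ _≤_ ≤.trans ≤.antisym ≤.≤-respˡ-≈

  +-monoˡ-≤ : ∀ r {s t} → s ≤ t → s + r ≤ t + r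
  +-monoˡ-≤ r {s} {t} s≤t = begin
    s + r  ≈⟨ +-comm s r ⟩
    r + s  ≤⟨ +-monoʳ-≤ r s≤t ⟩
    r + t  ≈⟨ +-comm r t ⟩
    t + r  ∎
    where open ≤-Reasoning

  +-mono-≤ : ∀ {r s t u} → r ≤ s → t ≤ u → r + t ≤ s + u
  +-mono-≤ r≤s t≤u = ≤.trans (+-monoˡ-≤ _ r≤s) (+-monoʳ-≤ _ t≤u)

  +-cancelˡ-≤ : ∀ r {s t} → r + s ≤ r + t → s ≤ t
  +-cancelˡ-≤ r {s} {t} le = begin
    s              ≈⟨ \\-leftDividesʳ r s ⟨
    - r + (r + s)  ≤⟨ +-monoʳ-≤ (- r) le ⟩
    - r + (r + t)  ≈⟨ \\-leftDividesʳ r t ⟩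
    t              ∎
    where open ≤-Reasoning

  +-monoʳ-< : ∀ r {s t} → s < t → r + s < r + t
  +-monoʳ-< r (s≤t , s≉t) = +-monoʳ-≤ r s≤t , s≉t ∘ ∙-cancelˡ r _ _

  s+[r-s]≈r : ∀ r s → s + (r - s) ≈ r
  s+[r-s]≈r r s = trans (sym (+-assoc s r (- s))) (xyx⁻¹≈y s r)

  r-[r-s]≈s : ∀ r s → r - (r - s) ≈ s
  r-[r-s]≈s r s = trans (+-congˡ (⁻¹-anti-homo‿- r s)) (s+[r-s]≈r s r)

  r≤s⇒0≤s-r : ∀ {r s} → r ≤ s → 0# ≤ s - r
  r≤s⇒0≤s-r {r} {s} r≤s = +-cancelˡ-≤ r (begin
    r + 0#       ≈⟨ +-identityʳ r ⟩
    r            ≤⟨ r≤s ⟩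
    s            ≈⟨ s+[r-s]≈r s r ⟨
    r + (s - r)  ∎)
    where open ≤-Reasoning

  r<s⇒0<s-r : ∀ {r s} → r < s → 0# < s - r
  r<s⇒0<s-r {r} {s} (r≤s , r≉s) = r≤s⇒0≤s-r r≤s , λ 0≈s-r → r≉s (begin
    r            ≈⟨ +-identityʳ r ⟨
    r + 0#       ≈⟨ +-congˡ 0≈s-r ⟩
    r + (s - r)  ≈⟨ s+[r-s]≈r s r ⟩
    s            ∎)
    where open SetoidReasoning setoid

  r≤s+t⇒r-t≤s : ∀ {r s t} → r ≤ s + t → r - t ≤ s
  r≤s+t⇒r-t≤s {r} {s} {t} le = +-cancelˡ-≤ t (begin
    t + (r - t)  ≈⟨ s+[r-s]≈r r t ⟩
    r            ≤⟨ le ⟩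
    s + t        ≈⟨ +-comm s t ⟩
    t + s        ∎)
    where open ≤-Reasoning

  r-t≤s⇒r≤s+t : ∀ {r s t} → r - t ≤ s → r ≤ s + t
  r-t≤s⇒r≤s+t {r} {s} {t} le = begin
    r            ≈⟨ s+[r-s]≈r r t ⟨
    t + (r - t)  ≤⟨ +-monoʳ-≤ t le ⟩
    t + s        ≈⟨ +-comm t s ⟩
    s + t        ∎
    where open ≤-Reasoning

  r≤r+s : ∀ {r s} → 0# ≤ s → r ≤ r + s
  r≤r+s {r} 0≤s = ≤.≤-respˡ-≈ (+-identityʳ r) (+-monoʳ-≤ r 0≤s)

  r<r+s : ∀ {r s} → 0# < s → r < r + s
  r<r+s {r} 0<s = ≤-<-trans (≤.reflexive (sym (+-identityʳ r))) (+-monoʳ-< r 0<s)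

  ∣r-s∣≤t⁻ : ∀ {r s t} → ∣ r - s ∣ ≤ t → r ≤ s + t × s ≤ r + t
  ∣r-s∣≤t⁻ {r} {s} {t} le =
    (begin
      r              ≈⟨ s+[r-s]≈r r s ⟨
      s + (r - s)    ≤⟨ +-monoʳ-≤ s (≤.trans (x≤x⊔y _ _) le) ⟩
      s + t          ∎) ,
    (begin
      s              ≈⟨ r-[r-s]≈s r s ⟨
      r - (r - s)    ≤⟨ +-monoʳ-≤ r (≤.trans (x≤y⊔x _ _) le) ⟩
      r + t          ∎)
    where open ≤-Reasoning

  ∣r-s∣≤t⁺ : ∀ {r s t} → r ≤ s + t → s ≤ r + t → ∣ r - s ∣ ≤ t
  ∣r-s∣≤t⁺ {r} {s} r≤s+t s≤r+t = ⊔-lub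
    (+-cancelˡ-≤ s (≤.≤-respˡ-≈ (sym (s+[r-s]≈r r s)) r≤s+t))
    (+-cancelˡ-≤ r (≤.≤-respˡ-≈ (sym (r-[r-s]≈s r s)) s≤r+t))

  0≤∣r∣ : ∀ r → 0# ≤ ∣ r ∣
  0≤∣r∣ r with ≤.total 0# r
  ... | inj₁ 0≤r = ≤.trans 0≤r (x≤x⊔y _ _)
  ... | inj₂ r≤0 = ≤.trans
    (≤.≤-respʳ-≈ (+-identityˡ (- r)) (r≤s⇒0≤s-r r≤0)) (x≤y⊔x _ _)

  ∣r∣≤t⁻ : ∀ {r t} → ∣ r ∣ ≤ t → r ≤ t × 0# ≤ r + t
  ∣r∣≤t⁻ {r} {t} le = ≤.trans (x≤x⊔y _ _) le , (begin
    0#       ≈⟨ -‿inverseʳ r ⟨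
    r - r    ≤⟨ +-monoʳ-≤ r (≤.trans (x≤y⊔x _ _) le) ⟩
    r + t    ∎)
    where open ≤-Reasoning

  ∣r∣≤t⁺ : ∀ {r t} → r ≤ t → 0# ≤ r + t → ∣ r ∣ ≤ t
  ∣r∣≤t⁺ {r} {t} r≤t 0≤r+t = ⊔-lub r≤t (+-cancelˡ-≤ r (≤.≤-respˡ-≈ (sym (-‿inverseʳ r)) 0≤r+t))

  *-monoˡ-≤ : ∀ {r} → 0# ≤ r → ∀ {s t} → s ≤ t → r * s ≤ r * t
  *-monoˡ-≤ {r} 0≤r {s} {t} s≤t = begin
    r * s                ≤⟨ r≤r+s (*-nonneg 0≤r (r≤s⇒0≤s-r s≤t)) ⟩
    r * s + r * (t - s)  ≈⟨ distribˡ r s (t - s) ⟨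
    r * (s + (t - s))    ≈⟨ *-congˡ (s+[r-s]≈r t s) ⟩
    r * t                ∎
    where open ≤-Reasoning

  0≤1 : 0# ≤ 1#
  0≤1 with ≤.total 0# 1#
  ... | inj₁ 0≤1 = 0≤1
  ... | inj₂ 1≤0 = ≤.≤-respʳ-≈
    (trans (-1*x≈-x (- 1#)) (-‿involutive 1#)) (*-nonneg 0≤-1 0≤-1)
    where
    0≤-1 : 0# ≤ - 1#
    0≤-1 = ≤.≤-respʳ-≈ (+-identityˡ (- 1#)) (r≤s⇒0≤s-r 1≤0)

  0<1 : 0# < 1#
  0<1 = 0≤1 , 0≉1

  >⇒≉0 : ∀ {r} → 0# < r → ¬ r ≈ 0#
  >⇒≉0 (_ , 0≉r) = 0≉r ∘ sym

  r/s*s≈r : ∀ r {s} → 0# < s → r / s * s ≈ r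
  r/s*s≈r r {s} 0<s = begin
    r * s ⁻¹ * s    ≈⟨ *-assoc r (s ⁻¹) s ⟩
    r * (s ⁻¹ * s)  ≈⟨ *-congˡ (trans (*-comm (s ⁻¹) s) (⁻¹-inverseʳ (>⇒≉0 0<s))) ⟩
    r * 1#          ≈⟨ *-identityʳ r ⟩
    r               ∎
    where open SetoidReasoning setoid

  0≤⁻¹ : ∀ {r} → 0# < r → 0# ≤ r ⁻¹
  0≤⁻¹ {r} 0<r with ≤.total 0# (r ⁻¹)
  ... | inj₁ 0≤r⁻¹ = 0≤r⁻¹
  ... | inj₂ r⁻¹≤0 = contradiction 1≤0 (<⇒≱ 0<1)
    where
    open ≤-Reasoning
    1≤0 : 1# ≤ 0#
    1≤0 = begin
      1#               ≈⟨ ⁻¹-inverseʳ (>⇒≉0 0<r) ⟨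
      r * r ⁻¹         ≤⟨ *-monoˡ-≤ (proj₁ 0<r) r⁻¹≤0 ⟩
      r * 0#           ≈⟨ zeroʳ r ⟩
      0#               ∎

  0≤/ : ∀ {r s} → 0# ≤ r → 0# < s → 0# ≤ r / s
  0≤/ 0≤r 0<s = *-nonneg 0≤r (0≤⁻¹ 0<s)

  0</ : ∀ {r s} → 0# < r → 0# < s → 0# < r / s
  0</ {r} {s} 0<r 0<s = 0≤/ (proj₁ 0<r) 0<s , λ 0≈r/s → proj₂ 0<r (begin
    0#         ≈⟨ zeroˡ s ⟨
    0# * s     ≈⟨ *-congʳ 0≈r/s ⟩
    r / s * s  ≈⟨ r/s*s≈r r 0<s ⟩
    r          ∎)
    where open SetoidReasoning setoid

  0<1+r : ∀ {r} → 0# ≤ r → 0# < 1# + r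
  0<1+r 0≤r = <-≤-trans 0<1 (r≤r+s 0≤r)

  2#*r≈r+r : ∀ r → 2# * r ≈ r + r
  2#*r≈r+r r = trans (distribʳ r 1# 1#) (+-cong (*-identityˡ r) (*-identityˡ r))

  halve : ∀ {r} → 0# < r → ∃ λ h → 0# < h × h + h ≈ r
  halve {r} 0<r = r / 2# , 0</ 0<r 0<2 , (begin
    r / 2# + r / 2#  ≈⟨ 2#*r≈r+r (r / 2#) ⟨
    2# * (r / 2#)    ≈⟨ *-comm 2# (r / 2#) ⟩
    r / 2# * 2#      ≈⟨ r/s*s≈r r 0<2 ⟩
    r                ∎)
    where
    open SetoidReasoning setoid
    0<2 : 0# < 2#
    0<2 = 0<1+r 0≤1

  ≤-approx : ∀ {r s} → (∀ η → 0# < η → r ≤ s + η) → r ≤ s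
  ≤-approx {r} {s} approx = decidable-stable em λ r≰s →
    let (h , 0<h , h+h≈r-s) = halve (r<s⇒0<s-r (≰⇒> r≰s)) in
    contradiction (approx h 0<h) (<⇒≱ (begin-strict
      s + h        <⟨ r<r+s 0<h ⟩
      s + h + h    ≈⟨ +-assoc s h h ⟩
      s + (h + h)  ≈⟨ +-congˡ h+h≈r-s ⟩
      s + (r - s)  ≈⟨ s+[r-s]≈r r s ⟩
      r            ∎))
    where open ≤-Reasoning

  -- Starting from `0#` settles the empty vector and leaves the maximum of a nonempty family of
  -- distances unchanged, as these are nonnegative.
  maximum : ∀ {n} → Vector ℝ n → ℝ
  maximum = Vector.foldr _⊔_ 0#

  0≤maximum : ∀ {n} (f : Vector ℝ n) → 0# ≤ maximum f
  0≤maximum {ℕ.zero}  f = ≤.refl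
  0≤maximum {ℕ.suc n} f = ≤.trans (0≤maximum (Vector.tail f)) (x≤y⊔x _ _)

  ≤maximum : ∀ {n} (f : Vector ℝ n) i → f i ≤ maximum f
  ≤maximum f zero    = x≤x⊔y _ _
  ≤maximum f (suc i) = ≤.trans (≤maximum (Vector.tail f) i) (x≤y⊔x _ _)

  maximum-least : ∀ {n} (f : Vector ℝ n) {t} → 0# ≤ t → (∀ i → f i ≤ t) → maximum f ≤ t
  maximum-least {ℕ.zero}  f 0≤t f≤t = 0≤t
  maximum-least {ℕ.suc n} f 0≤t f≤t = ⊔-lub (f≤t zero) (maximum-least (Vector.tail f) 0≤t (f≤t ∘ suc))

  module _ {S : Pred ℝ ℓ} (nonempty : Satisfiable S) (below : Satisfiable (LowerBound S)) where

    private
      above : Satisfiable (UpperBound (LowerBound S))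
      above = proj₁ nonempty , λ lb → lb (proj₂ nonempty)

    -- Since `inf` is the supremum of the lower bounds, the two axioms of `sup` trade places:
    -- `sup-least` shows that it is a lower bound, `sup-upper` that it is the greatest.
    inf-lower : LowerBound S (inf S)
    inf-lower s∈S = sup-least below above λ lb → lb s∈S

    inf-greatest : UpperBound (LowerBound S) (inf S)
    inf-greatest = sup-upper below above

    inf<⇒∃ : ∀ {r} → inf S < r → ∃ λ s → S s × s < r
    inf<⇒∃ {r} inf<r = decidable-stable em λ ∄ → contradiction
      (inf-greatest λ {s} s∈S → ≮⇒≥ λ s<r → ∄ (s , s∈S , s<r)) (<⇒≱ inf<r)

  module _ {S : Pred ℝ ℓ} (nonempty : Satisfiable S) (above : Satisfiable (UpperBound S)) where

    <sup⇒∃ : ∀ {r} → r < sup S → ∃ λ s → S s × r < s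
    <sup⇒∃ {r} r<sup = decidable-stable em λ ∄ → contradiction
      (sup-least nonempty above λ {s} s∈S → ≮⇒≥ λ r<s → ∄ (s , s∈S , r<s)) (<⇒≱ r<sup)

  -- `sup` acts on predicates and is not assumed to respect coextensionality, so the equality has to
  -- come from the universal property, which is available for nonempty bounded sets.
  sup-cong : ∀ {S T} → Satisfiable T → Satisfiable (UpperBound T) →
             S ⊆ T → T ⊆ S → sup S ≈ sup T
  sup-cong (t , t∈T) (b , T≤b) S⊆T T⊆S = ≤.antisym
    (sup-least (t , T⊆S t∈T) (b , λ s∈S → T≤b (S⊆T s∈S))
      λ s∈S → sup-upper (t , t∈T) (b , T≤b) (S⊆T s∈S))
    (sup-least (t , t∈T) (b , T≤b)
      λ t∈T → sup-upper (_ , T⊆S t∈T) (b , λ s∈S → T≤b (S⊆T s∈S)) (T⊆S t∈T))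

  inf-cong : ∀ {S T} → Satisfiable T → Satisfiable (LowerBound T) →
             S ⊆ T → T ⊆ S → inf S ≈ inf T
  inf-cong {S} {T} (t , t∈T) below S⊆T T⊆S = sup-cong below (t , λ lb → lb t∈T)
    (λ lb {_} t∈T → lb (T⊆S t∈T)) (λ lb {_} s∈S → lb (S⊆T s∈S))

-- The value space and its compact sets

module ValueProperties {ℓ} (em : ExcludedMiddle ℓ) (R : CompleteOrderedField ℓ) where
  open CompleteOrderedField R hiding (_≈_)
  open RealProperties em R
  open ValueSpace R
  open 𝔙
  private module R = CompleteOrderedField R

  -- Equivalent to `𝔡 v w ≤ t`, with the supremum and the absolute value unfolded, so that chains of
  -- errors can be added coordinate by coordinate.
  record Close (t : ℝ) (v w : 𝔙) : Set ℓ where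
    constructor mkClose
    field
      at : ∀ n → coord v n ≤ coord w n + t × coord w n ≤ coord v n + t

  open Close public

  module _ (v w : 𝔙) where

    private
      above : Satisfiable (UpperBound λ r → ∃ λ n → r R.≈ ∣ coord v n - coord w n ∣)
      above = let (B , v≤B) = bounded v ; (C , w≤C) = bounded w in
        B + C , λ { (n , r≈) → ≤.≤-respˡ-≈ (sym r≈)
          (bound n B C (∣r∣≤t⁻ (v≤B n)) (∣r∣≤t⁻ (w≤C n))) }
        where
        open ≤-Reasoning
        bound : ∀ n B C → coord v n ≤ B × 0# ≤ coord v n + B →
                coord w n ≤ C × 0# ≤ coord w n + C → ∣ coord v n - coord w n ∣ ≤ B + C
        bound n B C (v≤B , 0≤v+B) (w≤C , 0≤w+C) = ∣r-s∣≤t⁺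
          (begin
            coord v n                 ≤⟨ v≤B ⟩
            B                         ≤⟨ r≤r+s 0≤w+C ⟩
            B + (coord w n + C)       ≈⟨ x∙yz≈y∙xz B (coord w n) C ⟩
            coord w n + (B + C)       ∎)
          (begin
            coord w n                 ≤⟨ w≤C ⟩
            C                         ≤⟨ r≤r+s 0≤v+B ⟩
            C + (coord v n + B)       ≈⟨ x∙yz≈y∙zx C (coord v n) B ⟩
            coord v n + (B + C)       ∎)

    𝔡≤⇒Close : ∀ {t} → 𝔡 v w ≤ t → Close t v w
    𝔡≤⇒Close le .at n = ∣r-s∣≤t⁻ (≤.trans (sup-upper (_ , 0 , refl) above (n , refl)) le)

    Close⇒𝔡≤ : ∀ {t} → Close t v w → 𝔡 v w ≤ t
    Close⇒𝔡≤ close = sup-least (_ , 0 , refl) above λ { (n , r≈) →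
      ≤.≤-respˡ-≈ (sym r≈) (∣r-s∣≤t⁺ (proj₁ (at close n)) (proj₂ (at close n))) }

    Close-𝔡 : Close (𝔡 v w) v w
    Close-𝔡 = 𝔡≤⇒Close ≤.refl

    𝔡-nonneg : 0# ≤ 𝔡 v w
    𝔡-nonneg = ≤.trans (0≤∣r∣ _) (sup-upper (_ , 0 , refl) above (0 , refl))

  Close-sym : ∀ {t v w} → Close t v w → Close t w v
  Close-sym close .at n = proj₂ (at close n) , proj₁ (at close n)

  Close-trans : ∀ {s t u v w} → Close s u v → Close t v w → Close (s + t) u w
  Close-trans {s} {t} {u} {v} {w} uv vw .at n =
    (begin
      coord u n              ≤⟨ proj₁ (at uv n) ⟩
      coord v n + s          ≤⟨ +-monoˡ-≤ s (proj₁ (at vw n)) ⟩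
      coord w n + t + s      ≈⟨ xy∙z≈x∙zy (coord w n) t s ⟩
      coord w n + (s + t)    ∎) ,
    (begin
      coord w n              ≤⟨ proj₂ (at vw n) ⟩
      coord v n + t          ≤⟨ +-monoˡ-≤ t (proj₂ (at uv n)) ⟩
      coord u n + s + t      ≈⟨ +-assoc (coord u n) s t ⟩
      coord u n + (s + t)    ∎)
    where open ≤-Reasoning

  Close-mono : ∀ {s t v w} → s ≤ t → Close s v w → Close t v w
  Close-mono s≤t close .at n = ≤.trans (proj₁ (at close n)) (+-monoʳ-≤ _ s≤t) ,
                               ≤.trans (proj₂ (at close n)) (+-monoʳ-≤ _ s≤t)

  ≈⇒Close : ∀ {t v w} → 0# ≤ t → v ≈ w → Close t v w
  ≈⇒Close 0≤t v≈w .at n = ≤.trans (≤.reflexive (v≈w n)) (r≤r+s 0≤t) ,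
                          ≤.trans (≤.reflexive (sym (v≈w n))) (r≤r+s 0≤t)

  Close-approx : ∀ {t v w} → (∀ η → 0# < η → Close (t + η) v w) → Close t v w
  Close-approx {t} {v} {w} close .at n =
    ≤-approx (λ η 0<η → ≤.≤-respʳ-≈ (sym (+-assoc (coord w n) t η)) (proj₁ (at (close η 0<η) n))) ,
    ≤-approx (λ η 0<η → ≤.≤-respʳ-≈ (sym (+-assoc (coord v n) t η)) (proj₂ (at (close η 0<η) n)))

  Close-approx⇒≈ : ∀ {v w} → (∀ η → 0# < η → Close η v w) → v ≈ w
  Close-approx⇒≈ close n = ≤.antisym (≤-approx λ η 0<η → proj₁ (at (close η 0<η) n))
                                     (≤-approx λ η 0<η → proj₂ (at (close η 0<η) n))

  Close-resp : ∀ {t v v′ w w′} → v ≈ v′ → w ≈ w′ → Close t v w → Close t v′ w′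
  Close-resp v≈v′ w≈w′ close .at n =
    (begin
      _  ≈⟨ v≈v′ n ⟨
      _  ≤⟨ proj₁ (at close n) ⟩
      _  ≈⟨ +-congʳ (w≈w′ n) ⟩
      _  ∎) ,
    (begin
      _  ≈⟨ w≈w′ n ⟨
      _  ≤⟨ proj₂ (at close n) ⟩
      _  ≈⟨ +-congʳ (v≈v′ n) ⟩
      _  ∎)
    where open ≤-Reasoning

  𝔡-triangle : ∀ u v w → 𝔡 u w ≤ 𝔡 u v + 𝔡 v w
  𝔡-triangle u v w = Close⇒𝔡≤ u w (Close-trans (Close-𝔡 u v) (Close-𝔡 v w))

  𝔡-sym : ∀ v w → 𝔡 v w ≤ 𝔡 w v
  𝔡-sym v w = Close⇒𝔡≤ v w (Close-sym (Close-𝔡 w v))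

  ≈⇒𝔡< : ∀ {v w η} → v ≈ w → 0# < η → 𝔡 v w < η
  ≈⇒𝔡< {v} {w} v≈w 0<η = ≤-<-trans (Close⇒𝔡≤ v w (≈⇒Close ≤.refl v≈w)) 0<η

  𝔡-refl< : ∀ v {η} → 0# < η → 𝔡 v v < η
  𝔡-refl< v = ≈⇒𝔡< {v} {v} λ n → refl

  𝔡<-trans : ∀ u v w {h η} → h + h R.≈ η → 𝔡 u v < h → 𝔡 v w < h → 𝔡 u w < η
  𝔡<-trans u v w {h} {η} h+h≈η uv vw = begin-strict
    𝔡 u w          ≤⟨ 𝔡-triangle u v w ⟩
    𝔡 u v + 𝔡 v w  ≤⟨ +-monoˡ-≤ (𝔡 v w) (proj₁ uv) ⟩
    h + 𝔡 v w      <⟨ +-monoʳ-< h vw ⟩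
    h + h          ≈⟨ h+h≈η ⟩
    η              ∎
    where open ≤-Reasoning

  -- Connectives are functions on representatives of the points of the value space. Equal arguments
  -- are at distance zero, hence within every modulus of continuity, so the results are at distance
  -- zero too.
  Continuous⇒cong : ∀ {n} {u : Vector 𝔙 n → 𝔙} → Continuous u →
                    ∀ {v w} → (∀ i → v i ≈ w i) → u v ≈ u w
  Continuous⇒cong {u = u} continuous {v} {w} v≈w = Close-approx⇒≈ {u v} {u w} λ ε 0<ε →
    let (η , 0<η , near) = continuous v ε 0<ε in
    𝔡≤⇒Close _ _ (proj₁ (near w λ i → ≈⇒𝔡< {v i} {w i} (v≈w i) 0<η))

  𝟘 : 𝔙
  𝟘 = record { coord = λ _ → 0#
             ; bounded = 0# , λ _ → ∣r∣≤t⁺ ≤.refl (r≤r+s ≤.refl) }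

  Bounded : ∀ {a} → Pred 𝔙 a → Set _
  Bounded K = ∃ λ B → ∀ {v} → K v → Close B v 𝟘

  -- The open balls about `𝟘` cover everything, and the largest radius in a finite subcover is a
  -- bound.
  Compact⇒Bounded : ∀ {K} → Compact K → Bounded K
  Compact⇒Bounded compact =
    let (rs , covered) = compact ball ball-open λ {v} _ → 𝔡 v 𝟘 + 1# , r<r+s 0<1 in
    foldr _⊔_ 0# rs , λ {v} v∈K → 𝔡≤⇒Close v 𝟘 (≤-max rs (covered v∈K))
    where
    open ≤-Reasoning
    ball : ℝ → Pred 𝔙 ℓ
    ball r v = 𝔡 v 𝟘 < r

    ball-open : ∀ r → Open (ball r)
    ball-open r v v<r = r - 𝔡 v 𝟘 , r<s⇒0<s-r v<r , λ w near → begin-strict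
      𝔡 w 𝟘                  ≤⟨ 𝔡-triangle w v 𝟘 ⟩
      𝔡 w v + 𝔡 v 𝟘          ≈⟨ +-comm _ _ ⟩
      𝔡 v 𝟘 + 𝔡 w v          <⟨ +-monoʳ-< _ (≤-<-trans (𝔡-sym w v) near) ⟩
      𝔡 v 𝟘 + (r - 𝔡 v 𝟘)    ≈⟨ s+[r-s]≈r r _ ⟩
      r                      ∎

    ≤-max : ∀ rs {s} → Any (s <_) rs → s ≤ foldr _⊔_ 0# rs
    ≤-max (r ∷ rs) (here s<r)  = ≤.trans (proj₁ s<r) (x≤x⊔y r _)
    ≤-max (r ∷ rs) (there any) = ≤.trans (≤-max rs any) (x≤y⊔x r _)

  ℝ⁺ : Set ℓ
  ℝ⁺ = ∃ λ r → 0# < r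

  -- The starting value `1#` keeps the result positive when a finite subcover happens to be empty.
  minimum : List ℝ⁺ → ℝ
  minimum = foldr (λ r m → proj₁ r ⊓ m) 1#

  0<minimum : ∀ rs → 0# < minimum rs
  0<minimum []              = 0<1
  0<minimum ((r , 0<r) ∷ rs) with ⊓-sel r (minimum rs)
  ... | inj₁ ≈r = <-≤-trans 0<r (≤.reflexive (sym ≈r))
  ... | inj₂ ≈m = <-≤-trans (0<minimum rs) (≤.reflexive (sym ≈m))

  -- If `v` were outside `K`, the complements of the closed balls about `v` would cover `K`; the
  -- least radius of a finite subcover then gives a ball about `v` that misses `K`.
  Compact⇒Closed : ∀ {K} → K Respects _≈_ → Compact K → ∀ {v} →
                   (∀ η → 0# < η → ∃ λ w → K w × 𝔡 v w < η) → K v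
  Compact⇒Closed {K} respects compact {v} limit = decidable-stable em λ v∉K →
    let (rs , covered) = compact far far-open λ {w} w∈K →
          -- Half of the distance from `v` to `w` is a radius that `w` exceeds strictly, as `far`
          -- demands.
          let (h , 0<h , h+h≈) = halve (apart v∉K w∈K) in
          (h , 0<h) , <-≤-trans (r<r+s 0<h) (≤.reflexive h+h≈)
        (w , w∈K , near) = limit (minimum rs) (0<minimum rs)
    in <⇒≱ near (proj₁ (min-< rs (covered w∈K)))
    where
    open ≤-Reasoning
    far : ℝ⁺ → Pred 𝔙 ℓ
    far (r , _) w = r < 𝔡 v w

    far-open : ∀ r → Open (far r)
    far-open (r , _) w r<vw = 𝔡 v w - r , r<s⇒0<s-r r<vw , λ w′ near → ≰⇒> λ vw′≤r →
      <⇒≱ (begin-strict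
        𝔡 v w              ≤⟨ 𝔡-triangle v w′ w ⟩
        𝔡 v w′ + 𝔡 w′ w    ≤⟨ +-monoˡ-≤ _ vw′≤r ⟩
        r + 𝔡 w′ w         ≤⟨ +-monoʳ-≤ r (𝔡-sym w′ w) ⟩
        r + 𝔡 w w′         <⟨ +-monoʳ-< r near ⟩
        r + (𝔡 v w - r)    ≈⟨ s+[r-s]≈r _ r ⟩
        𝔡 v w              ∎) ≤.refl

    apart : ¬ K v → ∀ {w} → K w → 0# < 𝔡 v w
    apart v∉K {w} w∈K = ≰⇒> λ vw≤0 → v∉K (respects
      (Close-approx⇒≈ λ η 0<η → Close-sym (𝔡≤⇒Close v w (≤.trans vw≤0 (proj₁ 0<η)))) w∈K)

    min-< : ∀ rs {s} → Any (λ r → proj₁ r < s) rs → minimum rs < s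
    min-< (r ∷ rs) (here r<s)  = ≤-<-trans (x⊓y≤x _ _) r<s
    min-< (r ∷ rs) (there any) = ≤-<-trans (x⊓y≤y _ _) (min-< rs any)

  -- Finite products of compact sets

  Near : ∀ {n} → ℝ → Vector 𝔙 n → Vector 𝔙 n → Set ℓ
  Near η v w = ∀ i → 𝔡 (v i) (w i) < η

  VOpen : ∀ {n} → Pred (Vector 𝔙 n) ℓ → Set ℓ
  VOpen U = ∀ v → U v → ∃ λ η → 0# < η × (∀ w → Near η v w → U w)

  VCompact : ∀ {n} → Pred (Vector 𝔙 n) ℓ → Set (Level.suc ℓ)
  VCompact K = {I : Set ℓ} (U : I → Pred (Vector 𝔙 _) ℓ) → (∀ i → VOpen (U i)) →
    (∀ {v} → K v → ∃ λ i → U i v) →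
    ∃ λ (is : List I) → ∀ {v} → K v → Any (λ i → U i v) is

  Product : ∀ {n} → (Fin n → Pred 𝔙 ℓ) → Pred (Vector 𝔙 n) ℓ
  Product K v = ∀ k → K k (v k)

  Near-∷ : ∀ {n η v v′} {w w′ : Vector 𝔙 n} → 𝔡 v v′ < η → Near η w w′ →
           Near η (v Vector.∷ w) (v′ Vector.∷ w′)
  Near-∷ v~v′ w~w′ zero    = v~v′
  Near-∷ v~v′ w~w′ (suc i) = w~w′ i

  -- A vector agrees only pointwise with its head put before its tail. The two are at distance zero
  -- in each component, so an open set cannot separate them.
  VOpen-∷⁻ : ∀ {n} {U : Pred (Vector 𝔙 (ℕ.suc n)) ℓ} → VOpen U → ∀ {v} →
             U (Vector.head v Vector.∷ Vector.tail v) → U v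
  VOpen-∷⁻ open′ {v} Uv = let (η , 0<η , near) = open′ _ Uv in
    near _ λ { zero → 𝔡-refl< (v zero) 0<η ; (suc i) → 𝔡-refl< (v (suc i)) 0<η }

  -- Over each point of the first factor, compactness of the remaining product selects finitely many
  -- boxes, and these still cover the slices over a neighbourhood of that point. Finitely many such
  -- neighbourhoods cover the first factor.
  tube-lemma : ∀ {n} {K : Fin (ℕ.suc n) → Pred 𝔙 ℓ} → Compact (K zero) →
              VCompact (Product (K ∘ suc)) → VCompact (Product K)
  tube-lemma {n} {K} K₀-compact L-compact {I} U U-open U-cover =
    let (iss , covered) = K₀-compact tube tube-open tube-cover in
    concat iss , λ {v} v∈K → Any.map (λ {i} → VOpen-∷⁻ (U-open i))
      (concat⁺ (Any.map (λ (η , 0<η , near) → near _ (𝔡-refl< (v zero) 0<η) (v∈K ∘ suc))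
        (covered (v∈K zero))))
    where
    L : Pred (Vector 𝔙 n) ℓ
    L = Product (K ∘ suc)

    tube : List I → Pred 𝔙 ℓ
    tube is v = ∃ λ η → 0# < η × (∀ v′ → 𝔡 v v′ < η → ∀ {w} → L w →
      Any (λ i → U i (v′ Vector.∷ w)) is)

    tube-open : ∀ is → Open (tube is)
    tube-open is v (η , 0<η , near) = let (h , 0<h , h+h≈η) = halve 0<η in
      h , 0<h , λ v′ vv′ → h , 0<h , λ v″ v′v″ → near v″ (𝔡<-trans v v′ v″ h+h≈η vv′ v′v″)

    -- The radius around `v` belongs to the index, so that a finite subcover has a least one, which
    -- becomes the width of the tube. The radius around `w` is quantified, since it may vary with
    -- `w`.
    box : 𝔙 → I × ℝ⁺ → Pred (Vector 𝔙 n) ℓ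
    box v (i , η , _) w = ∃ λ η′ → 0# < η′ ×
      (∀ v′ w′ → 𝔡 v v′ < η → Near η′ w w′ → U i (v′ Vector.∷ w′))

    box-open : ∀ v j → VOpen (box v j)
    box-open v j w (η , 0<η , near) = let (h , 0<h , h+h≈η) = halve 0<η in
      h , 0<h , λ w′ ww′ → h , 0<h , λ v″ w″ vv″ w′w″ →
        near v″ w″ vv″ λ k → 𝔡<-trans (w k) (w′ k) (w″ k) h+h≈η (ww′ k) (w′w″ k)

    box-cover : ∀ {v} → K zero v → ∀ {w} → L w → ∃ λ j → box v j w
    box-cover {v} v∈K {w} w∈L =
      let (i , Uvw) = U-cover {v Vector.∷ w} λ { zero → v∈K ; (suc k) → w∈L k }
          (η , 0<η , near) = U-open i _ Uvw
      in (i , η , 0<η) , η , 0<η , λ v′ w′ vv′ ww′ → near _ (Near-∷ vv′ ww′)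

    slice : ∀ v v′ {w} js → 𝔡 v v′ < minimum (map proj₂ js) →
            Any (λ j → box v j w) js → Any (λ j → U (proj₁ j) (v′ Vector.∷ w)) js
    slice v v′ {w} (j ∷ js) near (here (η , 0<η , inside)) =
      here (inside _ _ (<-≤-trans near (x⊓y≤x _ _)) λ k → 𝔡-refl< (w k) 0<η)
    slice v v′ (j ∷ js) near (there any) = there (slice v v′ js (<-≤-trans near (x⊓y≤y _ _)) any)

    tube-cover : ∀ {v} → K zero v → ∃ λ is → tube is v
    tube-cover {v} v∈K =
      let (js , covered) = L-compact (box v) (box-open v) (box-cover v∈K) in
      map proj₁ js , minimum (map proj₂ js) , 0<minimum (map proj₂ js) ,
        λ v′ vv′ w∈L → map⁺ (slice v v′ js vv′ (covered w∈L))

  Product-compact : ∀ {n} {K : Fin n → Pred 𝔙 ℓ} → (∀ k → Compact (K k)) → VCompact (Product K)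
  -- All empty vectors are vacuously near each other, so the one member of the cover that contains a
  -- given empty vector contains them all.
  Product-compact {ℕ.zero}  K-compact U U-open U-cover =
    let (i , Ui) = U-cover {λ ()} λ () ; (_ , _ , near) = U-open i _ Ui in
    i ∷ [] , λ _ → here (near _ λ ())
  Product-compact {ℕ.suc n} {K} K-compact =
    tube-lemma {K = K} (K-compact zero) (Product-compact (K-compact ∘ suc))

  image-compact : ∀ {n} {K : Fin n → Pred 𝔙 ℓ} {u : Vector 𝔙 n → 𝔙} → (∀ k → Compact (K k)) →
                  Continuous u → Compact (λ v → ∃ λ w → Product K w × v ≈ u w)
  image-compact {n} {K} {u} K-compact continuous U U-open U-cover =
    let (is , covered) = Product-compact K-compact (λ i → U i ∘ u) preimage-open
          λ {w} w∈K → U-cover (w , w∈K , λ n → refl)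
    in is , λ {v} (w , w∈K , v≈uw) → Any.map (λ {i} Uuw →
      let (η , 0<η , near) = U-open i _ Uuw in
      near v (≈⇒𝔡< {u w} {v} (λ n → sym (v≈uw n)) 0<η)) (covered w∈K)
    where
    preimage-open : ∀ i → VOpen (U i ∘ u)
    preimage-open i w Uuw =
      let (ε , 0<ε , inside) = U-open i _ Uuw ; (η , 0<η , near) = continuous w ε 0<ε in
      η , 0<η , λ w′ ww′ → inside _ (near w′ ww′)

  vdist : ∀ {n} → Vector 𝔙 n → Vector 𝔙 n → ℝ
  vdist v w = maximum λ i → 𝔡 (v i) (w i)

  0≤vdist : ∀ {n} (v w : Vector 𝔙 n) → 0# ≤ vdist v w
  0≤vdist v w = 0≤maximum λ i → 𝔡 (v i) (w i)

  𝔡≤vdist : ∀ {n} (v w : Vector 𝔙 n) i → 𝔡 (v i) (w i) ≤ vdist v w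
  𝔡≤vdist v w = ≤maximum λ i → 𝔡 (v i) (w i)

  vdist-least : ∀ {n} (v w : Vector 𝔙 n) {t} → 0# ≤ t → (∀ i → 𝔡 (v i) (w i) ≤ t) → vdist v w ≤ t
  vdist-least v w = maximum-least λ i → 𝔡 (v i) (w i)

  vdist-triangle : ∀ {n} (v w z : Vector 𝔙 n) {t} → 0# ≤ t → (∀ i → 𝔡 (v i) (w i) ≤ t) →
                   vdist v z ≤ vdist w z + t
  vdist-triangle v w z {t} 0≤t vw≤t = vdist-least v z (≤.trans (0≤vdist w z) (r≤r+s 0≤t)) λ i → begin
    𝔡 (v i) (z i)                  ≤⟨ 𝔡-triangle (v i) (w i) (z i) ⟩
    𝔡 (v i) (w i) + 𝔡 (w i) (z i)  ≤⟨ +-mono-≤ (vw≤t i) (𝔡≤vdist w z i) ⟩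
    t + vdist w z                  ≈⟨ +-comm t _ ⟩
    vdist w z + t                  ∎
    where open ≤-Reasoning

-- Value sets, renaming and finite satisfiability

module LogicProperties {ℓ} (em : ExcludedMiddle ℓ) (R : CompleteOrderedField ℓ)
                       (copy : ValueSpace.IsometricCopy R) where
  open CompleteOrderedField R hiding (_≈_)
  open RealProperties em R
  open ValueSpace R
  open ValueProperties em R
  open CompactSet
  open IsometricCopy copy renaming (embed to ι)
  open ContinuousLogic R copy
  private module R = CompleteOrderedField R

  ι-close : ∀ {r s t} → r ≤ s + t → s ≤ r + t → Close t (ι r) (ι s)
  ι-close r≤s+t s≤r+t = 𝔡≤⇒Close _ _ (≤.≤-respˡ-≈ (sym (isometry _ _)) (∣r-s∣≤t⁺ r≤s+t s≤r+t))

  ι-close⁻ : ∀ {r s t} → Close t (ι r) (ι s) → r ≤ s + t × s ≤ r + t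
  ι-close⁻ close = ∣r-s∣≤t⁻ (≤.≤-respˡ-≈ (isometry _ _) (Close⇒𝔡≤ _ _ close))

  ι-cong : ∀ {r s} → r R.≈ s → ι r ≈ ι s
  ι-cong {r} {s} r≈s = Close-approx⇒≈ {ι r} {ι s} λ η 0<η →
    ι-close (≤.trans (≤.reflexive r≈s) (r≤r+s (proj₁ 0<η)))
            (≤.trans (≤.reflexive (sym r≈s)) (r≤r+s (proj₁ 0<η)))

  ι-injective : ∀ {r s} → ι r ≈ ι s → r R.≈ s
  ι-injective ιr≈ιs = ≤.antisym
    (≤.≤-respʳ-≈ (+-identityʳ _) (proj₁ close)) (≤.≤-respʳ-≈ (+-identityʳ _) (proj₂ close))
    where close = ι-close⁻ (≈⇒Close ≤.refl ιr≈ιs)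

  ≈ι-unique : ∀ v {r s} → v ≈ ι r → v ≈ ι s → r R.≈ s
  ≈ι-unique v v≈ιr v≈ιs = ι-injective λ n → trans (sym (v≈ιr n)) (v≈ιs n)

  -- The situation of a quantifier: `A` is the sort of the quantified variable and `f a` the value
  -- of the matrix at `a`.
  module RealValued {A : Set ℓ} (a₀ : A) {K : Pred 𝔙 ℓ} (K-respects : K Respects _≈_)
                    (K-compact : Compact K) (K-real : K ⊆ NonNegReal)
                    (f : A → 𝔙) (f∈K : ∀ a → K (f a)) where

    Values : Pred ℝ ℓ
    Values r = ∃ λ a → f a ≈ ι r

    Values-nonempty : Satisfiable Values
    Values-nonempty = let (r , _ , fa₀≈ιr) = K-real (f∈K a₀) in r , a₀ , fa₀≈ιr

    Values-nonneg : LowerBound Values 0#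
    Values-nonneg {s} (a , fa≈ιs) = let (r , 0≤r , fa≈ιr) = K-real (f∈K a) in
      ≤.≤-respʳ-≈ (≈ι-unique (f a) fa≈ιr fa≈ιs) 0≤r

    Values-below : Satisfiable (LowerBound Values)
    Values-below = 0# , λ r∈V → Values-nonneg r∈V

    Values-above : Satisfiable (UpperBound Values)
    Values-above =
      let (B , bound) = Compact⇒Bounded K-compact ; (s , s∈V) = Values-nonempty in
      -- The origin `𝟘` need not be `ι 0#`, so the bound on `K` is used as a bound on its diameter
      -- and anchored at one value `s`.
      s + (B + B) , λ r∈V → proj₁ (ι-close⁻ (Close-trans (bound (Values⊆K r∈V))
                                              (Close-sym (bound (Values⊆K s∈V)))))
      where
      Values⊆K : ∀ {r} → Values r → K (ι r)
      Values⊆K (a , fa≈ιr) = K-respects fa≈ιr (f∈K a)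

    limit∈K : ∀ {r} → (∀ η → 0# < η → ∃ λ s → Values s × (r ≤ s + η × s ≤ r + η)) → K (ι r)
    limit∈K {r} approx = Compact⇒Closed K-respects K-compact λ η 0<η →
      let (h , 0<h , h+h≈η) = halve 0<η ; (s , (a , fa≈ιs) , r≤s+h , s≤r+h) = approx h 0<h in
      ι s , K-respects fa≈ιs (f∈K a) ,
      ≤-<-trans (Close⇒𝔡≤ _ _ (ι-close r≤s+h s≤r+h)) (<-≤-trans (r<r+s 0<h) (≤.reflexive h+h≈η))

    sup∈K : K (ι (sup Values))
    sup∈K = limit∈K λ η 0<η →
      let (s , s∈V , sup-η<s) = <sup⇒∃ Values-nonempty Values-above (sup-η<sup η 0<η) in
      s , s∈V , sup≤ η (proj₁ sup-η<s) ,
      ≤.trans (sup-upper Values-nonempty Values-above s∈V) (r≤r+s (proj₁ 0<η))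
      where
      sup-η+η≈sup : ∀ η → sup Values - η + η R.≈ sup Values
      sup-η+η≈sup η = trans (+-comm _ η) (s+[r-s]≈r (sup Values) η)

      sup-η<sup : ∀ η → 0# < η → sup Values - η < sup Values
      sup-η<sup η 0<η = <-≤-trans (r<r+s 0<η) (≤.reflexive (sup-η+η≈sup η))

      sup≤ : ∀ η {s} → sup Values - η ≤ s → sup Values ≤ s + η
      sup≤ η le = ≤.≤-respˡ-≈ (sup-η+η≈sup η) (+-monoˡ-≤ η le)

    inf∈K : K (ι (inf Values))
    inf∈K = limit∈K λ η 0<η →
      let (s , s∈V , s<inf+η) = inf<⇒∃ Values-nonempty Values-below (r<r+s {inf Values} 0<η) in
      s , s∈V ,
      ≤.trans (inf-lower Values-nonempty Values-below s∈V) (r≤r+s (proj₁ 0<η)) , proj₁ s<inf+η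

  module _ {L : Language} where
    open Language L

    K-respects : ∀ {Γ} (ψ : Formula L Γ) → K L ψ Respects _≈_
    K-respects (pred P ts)     = respects (prValues P)
    K-respects (dist {s} t t′) = respects (dValues s)
    K-respects (conn u _ φs) v≈w (z , z∈K , v≈uz) = z , z∈K , λ n → trans (sym (v≈w n)) (v≈uz n)
    K-respects (Sup ψ _)       = K-respects ψ
    K-respects (Inf ψ _)       = K-respects ψ

    K-compact : ∀ {Γ} (ψ : Formula L Γ) → Compact (K L ψ)
    K-compact (pred P ts)             = compact (prValues P)
    K-compact (dist {s} t t′)         = compact (dValues s)
    K-compact (conn u continuous φs)  = image-compact {u = u} (λ i → K-compact (φs i)) continuous
    K-compact (Sup ψ _)               = K-compact ψ
    K-compact (Inf ψ _)               = K-compact ψ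

    module _ (M : Structure L) where
      open Structure M using (Tuple; nonempty; pr-value; d-value)

      -- In the quantifier cases the value set of the matrix suffices, because a compact set is
      -- closed and so contains the supremum and the infimum of values lying in it.
      eval∈K : ∀ {Γ} (ψ : Formula L Γ) (e : Tuple Γ) → K L ψ (eval L M ψ e)
      eval∈K (pred P ts)   e = pr-value P _
      eval∈K (dist t t′)   e = d-value _ _
      eval∈K (conn u _ φs) e = _ , (λ i → eval∈K (φs i) e) , λ n → refl
      eval∈K (Sup ψ real)  e = RealValued.sup∈K (nonempty _) (K-respects ψ) (K-compact ψ) real
        (λ a → eval L M ψ (a ∷ e)) (λ a → eval∈K ψ (a ∷ e))
      eval∈K (Inf ψ real)  e = RealValued.inf∈K (nonempty _) (K-respects ψ) (K-compact ψ) real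
        (λ a → eval L M ψ (a ∷ e)) (λ a → eval∈K ψ (a ∷ e))

      module Quantified {Γ s} (ψ : Formula L (s ∷ Γ)) (real : K L ψ ⊆ NonNegReal) (e : Tuple Γ) =
        RealValued (nonempty s) (K-respects ψ) (K-compact ψ) real
          (λ a → eval L M ψ (a ∷ e)) (λ a → eval∈K ψ (a ∷ e))

    -- Renaming of variables

    mutual
      renameTerm : ∀ {Γ Δ s} → Γ ⊑ Δ → Term L Γ s → Term L Δ s
      renameTerm ρ (var i)    = var (ρ i)
      renameTerm ρ (app f ts) = app f (renameTerms ρ ts)

      renameTerms : ∀ {Γ Δ ss} → Γ ⊑ Δ → All (Term L Γ) ss → All (Term L Δ) ss
      renameTerms ρ []       = []
      renameTerms ρ (t ∷ ts) = renameTerm ρ t ∷ renameTerms ρ ts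

    mutual
      rename : ∀ {Γ Δ} → Γ ⊑ Δ → Formula L Γ → Formula L Δ
      rename ρ (pred P ts)            = pred P (renameTerms ρ ts)
      rename ρ (dist t t′)            = dist (renameTerm ρ t) (renameTerm ρ t′)
      rename ρ (conn u continuous φs) = conn u continuous (λ i → rename ρ (φs i))
      rename ρ (Sup ψ real)           = Sup (rename (∷⁺ʳ _ ρ) ψ) (real ∘ K-rename (∷⁺ʳ _ ρ) ψ)
      rename ρ (Inf ψ real)           = Inf (rename (∷⁺ʳ _ ρ) ψ) (real ∘ K-rename (∷⁺ʳ _ ρ) ψ)

      -- A quantifier carries a proof that the value set of its matrix is real, so `rename` needs
      -- this inclusion to go under one. It holds because value sets do not depend on the terms in a
      -- formula.
      K-rename : ∀ {Γ Δ} (ρ : Γ ⊑ Δ) ψ → K L (rename ρ ψ) ⊆ K L ψ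
      K-rename ρ (pred P ts)   v∈K = v∈K
      K-rename ρ (dist t t′)   v∈K = v∈K
      K-rename ρ (conn u _ φs) (w , w∈K , v≈uw) = w , (λ i → K-rename ρ (φs i) (w∈K i)) , v≈uw
      K-rename ρ (Sup ψ _)     v∈K = K-rename (∷⁺ʳ _ ρ) ψ v∈K
      K-rename ρ (Inf ψ _)     v∈K = K-rename (∷⁺ʳ _ ρ) ψ v∈K

    module _ (M : Structure L) where
      open Structure M using (Tuple; Carrier; fun; pr; d)

      Agree : ∀ {Γ Δ} → Γ ⊑ Δ → Tuple Δ → Tuple Γ → Set ℓ
      Agree ρ e e′ = ∀ {s} (i : s ∈ _) → All.lookup e (ρ i) ≡ All.lookup e′ i

      Agree-∷ : ∀ {Γ Δ s} {ρ : Γ ⊑ Δ} {e e′} (a : Carrier s) → Agree ρ e e′ →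
                Agree (∷⁺ʳ s ρ) (a ∷ e) (a ∷ e′)
      Agree-∷ a agree (here ≡.refl) = ≡.refl
      Agree-∷ a agree (there i)     = agree i

      Agree-++ : ∀ {Γ Δ x} {ρ : Γ ⊑ Δ} {e e′} (a : Tuple x) → Agree ρ e e′ →
                 Agree (++⁺ʳ x ρ) (++⁺ a e) (++⁺ a e′)
      Agree-++ []      agree i             = agree i
      Agree-++ (a ∷ _) agree (here ≡.refl) = ≡.refl
      Agree-++ (_ ∷ a) agree (there i)     = Agree-++ a agree i

      mutual
        evalTerm-rename : ∀ {Γ Δ s} {ρ : Γ ⊑ Δ} (t : Term L Γ s) {e e′} → Agree ρ e e′ →
                          evalTerm L M (renameTerm ρ t) e ≡ evalTerm L M t e′
        evalTerm-rename (var i)    agree = agree i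
        evalTerm-rename (app f ts) agree = ≡.cong (fun f) (evalTerms-rename ts agree)

        evalTerms-rename : ∀ {Γ Δ ss} {ρ : Γ ⊑ Δ} (ts : All (Term L Γ) ss) {e e′} → Agree ρ e e′ →
                           evalTerms L M (renameTerms ρ ts) e ≡ evalTerms L M ts e′
        evalTerms-rename []       agree = ≡.refl
        evalTerms-rename (t ∷ ts) agree =
          ≡.cong₂ _∷_ (evalTerm-rename t agree) (evalTerms-rename ts agree)

      eval-rename : ∀ {Γ Δ} (ρ : Γ ⊑ Δ) (ψ : Formula L Γ) {e e′} → Agree ρ e e′ →
                    eval L M (rename ρ ψ) e ≈ eval L M ψ e′
      eval-rename ρ (pred P ts) agree n =
        reflexive (≡.cong (λ as → 𝔙.coord (pr P as) n) (evalTerms-rename ts agree))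
      eval-rename ρ (dist t t′) agree n =
        reflexive (≡.cong₂ (λ a b → 𝔙.coord (ι (d a b)) n)
          (evalTerm-rename t agree) (evalTerm-rename t′ agree))
      eval-rename ρ (conn u continuous φs) {e} {e′} agree =
        Continuous⇒cong {u = u} continuous
          {λ i → eval L M (rename ρ (φs i)) e} {λ i → eval L M (φs i) e′}
          λ i → eval-rename ρ (φs i) agree
      eval-rename ρ (Sup ψ real) {e} {e′} agree = ι-cong (sup-cong Values-nonempty Values-above
        (λ (a , eq) → a , λ n → trans (sym (eval-rename _ ψ (Agree-∷ {ρ = ρ} {e} {e′} a agree) n)) (eq n))
        (λ (a , eq) → a , λ n → trans (eval-rename _ ψ (Agree-∷ {ρ = ρ} {e} {e′} a agree) n) (eq n)))
        where open Quantified M ψ real e′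
      eval-rename ρ (Inf ψ real) {e} {e′} agree = ι-cong (inf-cong Values-nonempty Values-below
        (λ (a , eq) → a , λ n → trans (sym (eval-rename _ ψ (Agree-∷ {ρ = ρ} {e} {e′} a agree) n)) (eq n))
        (λ (a , eq) → a , λ n → trans (eval-rename _ ψ (Agree-∷ {ρ = ρ} {e} {e′} a agree) n) (eq n)))
        where open Quantified M ψ real e′

    -- Infima over a tuple of variables

    Infs : ∀ {Γ} x (ψ : Formula L (x ++ Γ)) → K L ψ ⊆ NonNegReal → Formula L Γ
    Infs []      ψ real = ψ
    Infs (s ∷ x) ψ real = Infs x (Inf ψ real) real

    module _ (M : Structure L) where
      open Structure M using (Tuple; nonempty)

      Infs-lower : ∀ {Γ} x (ψ : Formula L (x ++ Γ)) (real : K L ψ ⊆ NonNegReal) (a : Tuple x)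
                   {e r} → eval L M ψ (++⁺ a e) ≈ ι r →
                   ∃ λ s → s ≤ r × eval L M (Infs x ψ real) e ≈ ι s
      Infs-lower []      ψ real []      eq = _ , ≤.refl , eq
      Infs-lower (_ ∷ x) ψ real (c ∷ a) {e} eq =
        let (s , s≤inf , eq′) = Infs-lower x (Inf ψ real) real a {e} (λ n → refl) in
        s , ≤.trans s≤inf (inf-lower Values-nonempty Values-below (c , eq)) , eq′
        where open Quantified M ψ real (++⁺ a e)

      -- An infimum need not be attained, but every number strictly above it exceeds some value. One
      -- entry of the tuple is chosen for each quantifier, starting from the outermost.
      Infs-approached : ∀ {Γ} x (ψ : Formula L (x ++ Γ)) (real : K L ψ ⊆ NonNegReal) {e r η} →
                        eval L M (Infs x ψ real) e ≈ ι r → r < η →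
                        ∃ λ a → ∃ λ s → s < η × eval L M ψ (++⁺ a e) ≈ ι s
      Infs-approached []      ψ real eq r<η = [] , _ , r<η , eq
      Infs-approached (_ ∷ x) ψ real {e} {r} {η} eq r<η =
        let (a , s , s<η , eq′) = Infs-approached x (Inf ψ real) real {e} eq r<η
            open Quantified M ψ real (++⁺ a e)
            (t , (c , eq″) , t<η) = inf<⇒∃ Values-nonempty Values-below
              (≤-<-trans (≤.reflexive (ι-injective eq′)) s<η)
        in c ∷ a , t , t<η , eq″

    -- Formulas have no constants for elements of `M`. To speak of `φ(x,b₀)`, ..., `φ(x,bₙ₋₁)` at
    -- once, each `bⱼ` gets its own block of variables.
    copies : ℕ → List Sort → List Sort
    copies ℕ.zero    y = []
    copies (ℕ.suc n) y = y ++ copies n y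

    block : ∀ {n} y → Fin n → y ⊑ copies n y
    block y zero    i = ∈-++⁺ˡ i
    block y (suc j) i = ∈-++⁺ʳ y (block y j i)

    module _ {C : Sort → Set ℓ} where

      blocks : ∀ {n y} → Vector (All C y) n → All C (copies n y)
      blocks {ℕ.zero}  b = []
      blocks {ℕ.suc n} b = ++⁺ (Vector.head b) (blocks (Vector.tail b))

      lookup-++⁺ˡ : ∀ {x y s} (a : All C x) (b : All C y) (i : s ∈ x) →
                    All.lookup (++⁺ a b) (∈-++⁺ˡ i) ≡ All.lookup a i
      lookup-++⁺ˡ (c ∷ a) b (here ≡.refl) = ≡.refl
      lookup-++⁺ˡ (c ∷ a) b (there i)     = lookup-++⁺ˡ a b i

      lookup-++⁺ʳ : ∀ {x y s} (a : All C x) (b : All C y) (i : s ∈ y) →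
                    All.lookup (++⁺ a b) (∈-++⁺ʳ x i) ≡ All.lookup b i
      lookup-++⁺ʳ []      b i = ≡.refl
      lookup-++⁺ʳ (c ∷ a) b i = lookup-++⁺ʳ a b i

      lookup-blocks : ∀ {n y s} (b : Vector (All C y) n) j (i : s ∈ y) →
                      All.lookup (blocks b) (block y j i) ≡ All.lookup (b j) i
      lookup-blocks {n = ℕ.suc _} b zero    i = lookup-++⁺ˡ (b zero) (blocks (Vector.tail b)) i
      lookup-blocks {n = ℕ.suc _} {y} b (suc j) i = ≡.trans
        (lookup-++⁺ʳ (b zero) (blocks (Vector.tail b)) (block y j i))
        (lookup-blocks (Vector.tail b) j i)

    -- The target `r` will hold the values of a type. They enter the formula through the connective,
    -- as connectives may be arbitrary continuous functions.
    distanceTo : ∀ {n} → Vector 𝔙 n → Vector 𝔙 n → 𝔙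
    distanceTo r v = ι (vdist v r)

    distanceTo-continuous : ∀ {n} (r : Vector 𝔙 n) → Continuous (distanceTo r)
    distanceTo-continuous r v ε 0<ε = let (h , 0<h , h+h≈ε) = halve 0<ε in
      h , 0<h , λ w near → ≤-<-trans
        (Close⇒𝔡≤ (distanceTo r v) (distanceTo r w) (ι-close
          (vdist-triangle v w r (proj₁ 0<h) λ i → proj₁ (near i))
          (vdist-triangle w v r (proj₁ 0<h) λ i → ≤.trans (𝔡-sym (w i) (v i)) (proj₁ (near i)))))
        (<-≤-trans (r<r+s 0<h) (≤.reflexive h+h≈ε))

    module _ {x y : List Sort} (ϕ : Formula L (x ++ y)) where

      discrepancy : ∀ {n} → Vector 𝔙 n → Formula L (x ++ copies n y)
      discrepancy r = conn (distanceTo r) (distanceTo-continuous r)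
        λ j → rename (++⁺ʳ x (block y j)) ϕ

      discrepancy-real : ∀ {n} (r : Vector 𝔙 n) → K L (discrepancy r) ⊆ NonNegReal
      discrepancy-real r (w , _ , v≈) = _ , 0≤vdist w r , v≈

      eval-block : (M : Structure L) → let open Structure M in
                   ∀ {n} (a : Tuple x) (b : Vector (Tuple y) n) {e : Tuple (copies n y)} →
                   (∀ j → Agree M (block y j) e (b j)) → ∀ j →
                   eval L M (rename (++⁺ʳ x (block y j)) ϕ) (++⁺ a e) ≈ ⟦ ϕ ⟧ M a (b j)
      eval-block M a b {e} agree j =
        eval-rename M _ ϕ (Agree-++ M {ρ = block y j} {e} {b j} a (agree j))

      -- The infimum over x of the discrepancy between (φ(x,bⱼ))ⱼ and (φ(p,bⱼ))ⱼ
      -- vanishes in an extension realizing p, hence in M.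
      finitelySatisfiable : {M : Structure L} → let open Structure M in
        (p : S ⟦ ϕ ⟧ M) → ∀ {n} (b : Vector (Tuple y) n) {η} → 0# < η →
        ∃ λ a → ∀ j → Close η (⟦ ϕ ⟧ M a (b j)) (S.value p (b j))
      finitelySatisfiable {M} p {n} b {η} 0<η =
        let (s , s≤ , in-N) = Infs-lower N x θ (λ {v} → θ-real {v}) c {blocksN} (λ n → refl)
            (a , t , t<η , in-M) = Infs-approached M x θ (λ {v} → θ-real {v}) {blocks b} {s} {η}
              (λ n → trans (sym (elementary (Infs x θ (λ {v} → θ-real {v})) (blocks b) n)) (in-N n))
              (≤-<-trans (≤.trans s≤ distance-in-N) 0<η)
        in a , λ j → Close-resp (eval-block M a b (λ j → lookup-blocks b j) j) (λ n → refl)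
             (𝔡≤⇒Close (values M (++⁺ a (blocks b)) j) (r j) 
               (≤.trans (𝔡≤vdist (values M (++⁺ a (blocks b))) r j)
                 (≤.trans (≤.reflexive (ι-injective in-M)) (proj₁ t<η))))
        where
        open S p using (N; M≼N) renaming (realization to c)
        open _≼_ M≼N using (elementary) renaming (map to map-N)

        values : (M : Structure L) → Structure.Tuple M (x ++ copies n y) → Vector 𝔙 n
        values M e j = eval L M (rename (++⁺ʳ x (block y j)) ϕ) e

        r : Vector 𝔙 n
        r j = S.value p (b j)

        θ : Formula L (x ++ copies n y)
        θ = discrepancy r

        θ-real : K L θ ⊆ NonNegReal
        θ-real {v} = discrepancy-real r {v}

        blocksN : Structure.Tuple N (copies n y)
        blocksN = All.map map-N (blocks b)

        agree-N : ∀ j → Agree N (block y j) blocksN (All.map map-N (b j))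
        agree-N j i = ≡.trans (lookup-map (blocks b) (block y j i))
          (≡.trans (≡.cong map-N (lookup-blocks b j i)) (≡.sym (lookup-map (b j) i)))

        distance-in-N : vdist (values N (++⁺ c blocksN)) r ≤ 0#
        distance-in-N = vdist-least (values N (++⁺ c blocksN)) r ≤.refl λ j →
          Close⇒𝔡≤ (values N (++⁺ c blocksN) j) (r j) (≈⇒Close ≤.refl λ n →
            trans (eval-block N c (λ j → All.map map-N (b j)) agree-N j n) (S.realizes p (b j) n))

-- Infinite combinatorics

module InfiniteRamsey {ℓ} (em : ExcludedMiddle ℓ) where

  Increasing : (ℕ → ℕ) → Set
  Increasing f = ∀ {i j} → i ℕ.< j → f i ℕ.< f j

  increasing : ∀ {f} → (∀ n → f n ℕ.< f (ℕ.suc n)) → Increasing f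
  increasing step {i} {ℕ.suc j} i<1+j with ℕ.m<1+n⇒m<n∨m≡n i<1+j
  ... | inj₁ i<j    = ℕ.<-trans (increasing step i<j) (step j)
  ... | inj₂ ≡.refl = step i

  subsequence : {P : ℕ → Set ℓ} → (∀ N → ∃ λ n → N ℕ.≤ n × P n) →
                ∃ λ f → Increasing f × ∀ n → P (f n)
  subsequence {P} frequently = index , increasing increases , holds
    where
    index : ℕ → ℕ
    index ℕ.zero    = proj₁ (frequently 0)
    index (ℕ.suc n) = proj₁ (frequently (ℕ.suc (index n)))

    increases : ∀ n → index n ℕ.< index (ℕ.suc n)
    increases n = proj₁ (proj₂ (frequently (ℕ.suc (index n))))

    holds : ∀ n → P (index n)
    holds ℕ.zero    = proj₂ (proj₂ (frequently 0))
    holds (ℕ.suc n) = proj₂ (proj₂ (frequently (ℕ.suc (index n))))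

  Uniform : (P Q : ℕ → Set ℓ) → Set ℓ
  Uniform P Q = (∀ n → P n) ⊎ (∀ n → Q n)

  -- Either `Q` holds from some index on, and a shift suffices, or `P` holds at arbitrarily large
  -- indices.
  pigeonhole : {P Q : ℕ → Set ℓ} → (∀ n → P n ⊎ Q n) →
               ∃ λ f → Increasing f × Uniform (P ∘ f) (Q ∘ f)
  pigeonhole {P} {Q} P⊎Q with em {∃ λ N → ∀ n → N ℕ.≤ n → Q n}
  ... | yes (N , eventually) = (N ℕ.+_) , ℕ.+-monoʳ-< N , inj₂ λ n → eventually _ (ℕ.m≤m+n N n)
  ... | no ¬eventually =
    let (f , f-increasing , Pf) = subsequence {P} λ N → decidable-stable em λ ∄ →
          ¬eventually (N , λ n N≤n → Q-otherwise (λ Pn → ∄ (n , N≤n , Pn)) (P⊎Q n))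
    in f , f-increasing , inj₁ Pf
    where
    Q-otherwise : ∀ {n} → ¬ P n → P n ⊎ Q n → Q n
    Q-otherwise ¬P (inj₁ Pn) = contradiction Pn ¬P
    Q-otherwise ¬P (inj₂ Qn) = Qn

  module _ {P Q : ℕ → ℕ → Set ℓ} (P⊎Q : ∀ {i j} → i ℕ.< j → P i j ⊎ Q i j) where

    private
      Enumeration : Set
      Enumeration = ∃ Increasing

      -- The first term is held fixed while the tail is thinned until all its pairs with that term
      -- have one colour. This tail is the next stage, so every later stage inherits the colour.
      refine : (e : Enumeration) → let (f , _) = e in
        ∃ λ g → Increasing g ×
          Uniform (λ n → P (f 0) (f (ℕ.suc (g n)))) (λ n → Q (f 0) (f (ℕ.suc (g n))))
      refine (f , f-increasing) = pigeonhole λ n → P⊎Q (f-increasing {0} {ℕ.suc n} (ℕ.s≤s ℕ.z≤n))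

      stage : ℕ → Enumeration
      stage ℕ.zero    = (λ n → n) , λ i<j → i<j
      stage (ℕ.suc k) = let (f , f-increasing) = stage k ; (g , g-increasing , _) = refine (stage k) in
        f ∘ ℕ.suc ∘ g , λ {_} {_} i<j → f-increasing (ℕ.s<s (g-increasing i<j))

      element : ℕ → ℕ → ℕ
      element k = proj₁ (stage k)

      nested : ∀ {k l} → k ℕ.≤ l → ∀ n → ∃ λ m → element l n ≡ element k m
      nested {l = ℕ.zero}  ℕ.z≤n n = n , ≡.refl
      nested {l = ℕ.suc l} k≤1+l n with ℕ.m≤n⇒m<n∨m≡n k≤1+l
      ... | inj₁ (ℕ.s≤s k≤l) = nested k≤l _
      ... | inj₂ ≡.refl      = n , ≡.refl

      later : (S : ℕ → ℕ → Set ℓ) → ∀ k → (∀ n → S (element k 0) (element (ℕ.suc k) n)) →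
              ∀ {l} → k ℕ.< l → S (element k 0) (element l 0)
      later S k all k<l = let (m , eq) = nested k<l 0 in ≡.subst (S _) (≡.sym eq) (all m)

      colour : ∀ k → (∀ n → P (element k 0) (element (ℕ.suc k) n)) ⊎
                     (∀ n → Q (element k 0) (element (ℕ.suc k) n))
      colour k = proj₂ (proj₂ (refine (stage k)))

    -- Among the first terms of the stages, the colour of a pair is determined by the earlier one
    -- alone; a second use of the pigeonhole principle makes it constant.
    ramsey : ∃ λ f → (∀ i j → i ℕ.< j → P (f i) (f j)) ⊎ (∀ i j → i ℕ.< j → Q (f i) (f j))
    ramsey with pigeonhole colour
    ... | g , g-increasing , inj₁ all =
      (λ i → element (g i) 0) , inj₁ λ i j i<j → later P (g i) (all i) (g-increasing i<j)
    ... | g , g-increasing , inj₂ all =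
      (λ i → element (g i) 0) , inj₂ λ i j i<j → later Q (g i) (all i) (g-increasing i<j)

module _ {a ℓ} {A : Set a} {R : A → A → Set ℓ} (extend : ∀ as → ∃ λ a → All (R a) as) where

  private
    history : ℕ → List A
    history ℕ.zero    = []
    history (ℕ.suc n) = proj₁ (extend (history n)) ∷ history n

    All-history : ∀ {p} {P : A → Set p} {i j} → i ℕ.< j → All P (history j) →
                  P (proj₁ (extend (history i)))
    All-history {j = ℕ.suc j} i<1+j (p ∷ ps) with ℕ.m<1+n⇒m<n∨m≡n i<1+j
    ... | inj₁ i<j    = All-history i<j ps
    ... | inj₂ ≡.refl = p

  -- Each term is chosen against the list of all its predecessors, so one-step extension gives the
  -- relation for all pairs and not only for consecutive ones.
  extendingSequence : ∃ λ f → ∀ {i j} → i ℕ.< j → R (f j) (f i)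
  extendingSequence = (λ n → proj₁ (extend (history n))) ,
    λ {i} {j} i<j → All-history i<j (proj₂ (extend (history j)))

-- Lipschitz extension

module McShaneExtension {ℓ} (em : ExcludedMiddle ℓ) (R : CompleteOrderedField ℓ) where
  open CompleteOrderedField R hiding (_≈_)
  open RealProperties em R
  open ValueSpace R
  open ValueProperties em R
  open 𝔙
  private module R = CompleteOrderedField R

  module Extension {B : Set ℓ} (b₀ : B) {n} (z : B → Vector 𝔙 n) (f : B → 𝔙)
                   {T} (f-bounded : ∀ b → Close T (f b) 𝟘)
                   {c} (0≤c : 0# ≤ c) where

    Values : Vector 𝔙 n → ℕ → Pred ℝ ℓ
    Values v k r = ∃ λ b → r R.≈ coord (f b) k + c * vdist v (z b)

    private
      0≤c*vdist : ∀ v b → 0# ≤ c * vdist v (z b)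
      0≤c*vdist v b = *-nonneg 0≤c (0≤vdist v (z b))

      Values-nonempty : ∀ v k → Satisfiable (Values v k)
      Values-nonempty v k = _ , b₀ , refl

      -T≤Values : ∀ v k → LowerBound (Values v k) (0# - T)
      -T≤Values v k {s} (b , s≈) = r≤s+t⇒r-t≤s (begin
        0#                                       ≤⟨ proj₂ (at (f-bounded b) k) ⟩
        coord (f b) k + T                        ≤⟨ +-monoˡ-≤ T (r≤r+s (0≤c*vdist v b)) ⟩
        coord (f b) k + c * vdist v (z b) + T    ≈⟨ +-congʳ s≈ ⟨
        s + T                                    ∎)
        where open ≤-Reasoning

      Values-below : ∀ v k → Satisfiable (LowerBound (Values v k))
      Values-below v k = 0# - T , λ s∈V → -T≤Values v k s∈V

      inf≤ : ∀ v k b → inf (Values v k) ≤ coord (f b) k + c * vdist v (z b)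
      inf≤ v k b = inf-lower (Values-nonempty v k) (Values-below v k) (b , refl)

      -T≤inf : ∀ v k → 0# - T ≤ inf (Values v k)
      -T≤inf v k = inf-greatest (Values-nonempty v k) (Values-below v k) (-T≤Values v k)

    -- Working coordinatewise costs nothing: under the supremum metric, a family of real functions
    -- with a common Lipschitz constant keeps that constant. Boundedness over all coordinates comes
    -- from the single term at `b₀` above and from the bound on `f` below.
    extension : Vector 𝔙 n → 𝔙
    extension v .coord k = inf (Values v k)
    extension v .bounded = T + c * vdist v (z b₀) , λ k → ∣r∣≤t⁺
      (begin
        inf (Values v k)                      ≤⟨ inf≤ v k b₀ ⟩
        coord (f b₀) k + c * vdist v (z b₀)   ≤⟨ +-monoˡ-≤ _ (proj₁ (at (f-bounded b₀) k)) ⟩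
        0# + T + c * vdist v (z b₀)           ≈⟨ +-congʳ (+-identityˡ T) ⟩
        T + c * vdist v (z b₀)                ∎)
      (begin
        0#                                             ≤⟨ r-t≤s⇒r≤s+t (-T≤inf v k) ⟩
        inf (Values v k) + T                           ≤⟨ +-monoʳ-≤ _ (r≤r+s (0≤c*vdist v b₀)) ⟩
        inf (Values v k) + (T + c * vdist v (z b₀))    ∎)
      where open ≤-Reasoning

    ≤-extension : ∀ v k {r t} → (∀ b → r ≤ coord (f b) k + c * vdist v (z b) + t) →
                  r ≤ coord (extension v) k + t
    ≤-extension v k le = r-t≤s⇒r≤s+t (inf-greatest (Values-nonempty v k) (Values-below v k)
      λ { (b , s≈) → ≤.≤-respʳ-≈ (sym s≈) (r≤s+t⇒r-t≤s (le b)) })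

    extension-lipschitz : ∀ v w {t} → 0# ≤ t → (∀ i → 𝔡 (v i) (w i) ≤ t) →
                          𝔡 (extension v) (extension w) ≤ c * t
    extension-lipschitz v w {t} 0≤t vw≤t = Close⇒𝔡≤ (extension v) (extension w)
      (mkClose λ k → one-sided v w vw≤t k ,
                     one-sided w v (λ i → ≤.trans (𝔡-sym (w i) (v i)) (vw≤t i)) k)
      where
      open ≤-Reasoning
      one-sided : ∀ v w → (∀ i → 𝔡 (v i) (w i) ≤ t) → ∀ k →
                  coord (extension v) k ≤ coord (extension w) k + c * t
      one-sided v w vw≤t k = ≤-extension w k λ b → begin
        coord (extension v) k                              ≤⟨ inf≤ v k b ⟩
        coord (f b) k + c * vdist v (z b)                  ≤⟨ +-monoʳ-≤ _ (*-monoˡ-≤ 0≤c (triangle b)) ⟩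
        coord (f b) k + c * (vdist w (z b) + t)            ≈⟨ +-congˡ (distribˡ c _ t) ⟩
        coord (f b) k + (c * vdist w (z b) + c * t)        ≈⟨ +-assoc _ _ _ ⟨
        coord (f b) k + c * vdist w (z b) + c * t          ∎
        where
        triangle : ∀ b → vdist v (z b) ≤ vdist w (z b) + t
        triangle b = vdist-triangle v w (z b) 0≤t vw≤t

    extension-continuous : Continuous extension
    extension-continuous v ε 0<ε = η , 0<η , λ w near → begin-strict
      𝔡 (extension v) (extension w)  ≤⟨ extension-lipschitz v w (proj₁ 0<η) (λ i → proj₁ (near i)) ⟩
      c * η                          <⟨ r<r+s 0<η ⟩
      c * η + η                      ≈⟨ +-comm (c * η) η ⟩
      η + c * η                      ≈⟨ +-congʳ (*-identityˡ η) ⟨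
      1# * η + c * η                 ≈⟨ distribʳ η 1# c ⟨
      (1# + c) * η                   ≈⟨ *-comm (1# + c) η ⟩
      η * (1# + c)                   ≈⟨ r/s*s≈r ε (0<1+r 0≤c) ⟩
      ε                              ∎
      where
      open ≤-Reasoning
      -- The summand `1#` keeps the divisor positive when `c` is zero and leaves the room `η` that
      -- makes the estimate strict.
      η = ε / (1# + c)
      0<η : 0# < η
      0<η = 0</ 0<ε (0<1+r 0≤c)

    -- Where z b and z b′ are more than δ apart, the penalty is at least c * δ,
    -- which bounds the oscillation of f.
    extension-interpolates : ∀ {δ θ} → 0# ≤ θ → (∀ b b′ → Close (c * δ) (f b) (f b′)) →
      (∀ b b′ → (∀ i → Close δ (z b i) (z b′ i)) → Close θ (f b) (f b′)) →
      ∀ b → Close θ (extension (z b)) (f b)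
    extension-interpolates {δ} {θ} 0≤θ f-oscillation determined b .at k =
      (begin
        coord (extension (z b)) k               ≤⟨ inf≤ (z b) k b ⟩
        coord (f b) k + c * vdist (z b) (z b)   ≤⟨ +-monoʳ-≤ _ (*-monoˡ-≤ 0≤c vdist≤0) ⟩
        coord (f b) k + c * 0#                  ≈⟨ +-congˡ (zeroʳ c) ⟩
        coord (f b) k + 0#                      ≤⟨ +-monoʳ-≤ _ 0≤θ ⟩
        coord (f b) k + θ                       ∎) ,
      ≤-extension (z b) k bound
      where
      open ≤-Reasoning
      vdist≤0 : vdist (z b) (z b) ≤ 0#
      vdist≤0 = vdist-least (z b) (z b) ≤.refl λ i →
        Close⇒𝔡≤ (z b i) (z b i) (≈⇒Close ≤.refl λ _ → refl)

      bound : ∀ b′ → coord (f b) k ≤ coord (f b′) k + c * vdist (z b) (z b′) + θ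
      bound b′ with ≤.total (vdist (z b) (z b′)) δ
      ... | inj₁ vdist≤δ = begin
        coord (f b) k                                   ≤⟨ proj₁ (at (determined b b′ near) k) ⟩
        coord (f b′) k + θ                              ≤⟨ +-monoˡ-≤ θ (r≤r+s (0≤c*vdist (z b) b′)) ⟩
        coord (f b′) k + c * vdist (z b) (z b′) + θ     ∎
        where
        near : ∀ i → Close δ (z b i) (z b′ i)
        near i = 𝔡≤⇒Close (z b i) (z b′ i) (≤.trans (𝔡≤vdist (z b) (z b′) i) vdist≤δ)
      ... | inj₂ δ≤vdist = begin
        coord (f b) k                                   ≤⟨ proj₁ (at (f-oscillation b b′) k) ⟩
        coord (f b′) k + c * δ                          ≤⟨ +-monoʳ-≤ _ (*-monoˡ-≤ 0≤c δ≤vdist) ⟩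
        coord (f b′) k + c * vdist (z b) (z b′)         ≤⟨ r≤r+s 0≤θ ⟩
        coord (f b′) k + c * vdist (z b) (z b′) + θ     ∎

-- Definability of types

module Definability {ℓ} (em : ExcludedMiddle ℓ) (R : CompleteOrderedField ℓ)
                    (copy : ValueSpace.IsometricCopy R)
                    {L : ContinuousLogic.Language R copy}
                    (M : ContinuousLogic.Structure R copy L)
                    {x y : List (ContinuousLogic.Language.Sort L)}
                    (ϕ : ContinuousLogic.Formula R copy L (x ++ y)) where
  open CompleteOrderedField R hiding (_≈_)
  open RealProperties em R
  open ValueSpace R
  open ValueProperties em R
  open ContinuousLogic R copy
  open LogicProperties em R copy
  open Structure M using (Tuple; nonempty)
  private module R = CompleteOrderedField R

  φ : Bivariate x y
  φ = ⟦ ϕ ⟧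

  module _ (p : S φ M) {ε γ δ} (stable : Stable φ M ε) (δ<γ : δ < γ) where

    Determines : List (Tuple x) → Set ℓ
    Determines as = ∀ b b′ → All (λ a → Close δ (φ M a b) (φ M a b′)) as →
      Close (2# * ε + γ) (S.value p b) (S.value p b′)

    private
      record Witness : Set ℓ where
        field
          a     : Tuple x
          b b′  : Tuple y
          apart : ¬ Close (2# * ε + γ) (S.value p b) (S.value p b′)

      open Witness

      -- Half of the slack `γ - δ`, to be spent once at `b` and once at `b′`.
      η : ℝ
      η = proj₁ (halve (r<s⇒0<s-r δ<γ))

      0<η : 0# < η
      0<η = proj₁ (proj₂ (halve (r<s⇒0<s-r δ<γ)))

      η+η≈γ-δ : η + η R.≈ γ - δ
      η+η≈γ-δ = proj₂ (proj₂ (halve (r<s⇒0<s-r δ<γ)))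

      Approximates : Tuple x → Tuple y → Set ℓ
      Approximates a b = Close η (φ M a b) (S.value p b)

      record Extends (new old : Witness) : Set ℓ where
        field
          close   : Close δ (φ M (a old) (b new)) (φ M (a old) (b′ new))
          approx  : Approximates (a new) (b old)
          approx′ : Approximates (a new) (b′ old)

      approximant : (bs : List (Tuple y)) → ∃ λ a → All (Approximates a) bs
      approximant bs = let (a , approx) = finitelySatisfiable ϕ p (lookup bs) 0<η in
        a , ≡.subst (All _) (tabulate-lookup bs) (tabulate⁺ approx)

      extend : (∀ as → ¬ Determines as) → ∀ ws → ∃ λ w → All (Extends w) ws
      extend undetermined ws =
        let (b₀ , b₀′ , close , b₀-apart) = undetermined⁻ (map a ws)
            -- Both families are put in one list so that the same `a₀` imitates `p` at every old `b`
            -- and every old `b′`.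
            (a₀ , approx) = approximant (map b ws ++ map b′ ws)
            (approx-b , approx-b′) = ++⁻ (map b ws) approx
        in record { a = a₀ ; b = b₀ ; b′ = b₀′ ; apart = b₀-apart } ,
           All.zipWith (λ (c , u , v) → record { close = c ; approx = u ; approx′ = v })
             (map⁻ close , All.zip (map⁻ approx-b , map⁻ approx-b′))
        where
        undetermined⁻ : ∀ as → ∃ λ b → ∃ λ b′ →
          All (λ a → Close δ (φ M a b) (φ M a b′)) as ×
          ¬ Close (2# * ε + γ) (S.value p b) (S.value p b′)
        undetermined⁻ as = decidable-stable em λ ∄ → undetermined as λ b b′ close →
          decidable-stable em λ b-apart → ∄ (b , b′ , close , b-apart)

      Asymmetric Asymmetric′ : Witness → Witness → Set ℓ
      Asymmetric  v w = ε ≤ 𝔡 (φ M (a v) (b w)) (φ M (a w) (b v))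
      Asymmetric′ v w = ε ≤ 𝔡 (φ M (a v) (b′ w)) (φ M (a w) (b′ v))

      total-error : η + (ε + (δ + (ε + η))) R.≈ 2# * ε + γ
      total-error = begin
        η + (ε + (δ + (ε + η)))   ≈⟨ solve 3 (λ η ε δ →
                                         η ⊕ (ε ⊕ (δ ⊕ (ε ⊕ η))) ⊜ (ε ⊕ ε) ⊕ (δ ⊕ (η ⊕ η)))
                                       refl η ε δ ⟩
        (ε + ε) + (δ + (η + η))   ≈⟨ +-cong (sym (2#*r≈r+r ε)) (+-congˡ η+η≈γ-δ) ⟩
        2# * ε + (δ + (γ - δ))    ≈⟨ +-congˡ (s+[r-s]≈r γ δ) ⟩
        2# * ε + γ                ∎
        where
        open SetoidReasoning setoid
        open CommutativeMonoidSolver +-commutativeMonoid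

      -- φ(p,b) ~ φ(a new, b) ~ φ(a, b new) ~ φ(a, b′ new) ~ φ(a new, b′) ~ φ(p,b′) for
      -- b = b old, b′ = b′ old, a = a old, with errors η, ε, δ, ε, η.
      extends⇒asymmetric : ∀ old new → Extends new old → Asymmetric old new ⊎ Asymmetric′ old new
      extends⇒asymmetric old new extends
        with ≤.total ε (𝔡 (φ M (a old) (b new)) (φ M (a new) (b old)))
           | ≤.total ε (𝔡 (φ M (a old) (b′ new)) (φ M (a new) (b′ old)))
      ... | inj₁ ε≤ | _        = inj₁ ε≤
      ... | inj₂ _  | inj₁ ε≤  = inj₂ ε≤
      ... | inj₂ ≤ε | inj₂ ≤ε′ = contradiction
        (Close-mono (≤.reflexive total-error)
          (Close-trans (Close-sym approx)
          (Close-trans (Close-sym (𝔡≤⇒Close _ _ ≤ε))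
          (Close-trans close
          (Close-trans (𝔡≤⇒Close _ _ ≤ε′) approx′)))))
        (apart old)
        where open Extends extends

    determined : ∃ Determines
    determined = decidable-stable em λ ∄ →
      let (w , extends) = extendingSequence (extend λ as det → ∄ (as , det)) in
      unstable w (InfiniteRamsey.ramsey em λ {i} {j} i<j → extends⇒asymmetric (w i) (w j) (extends i<j))
      where
      unstable : ∀ w → ¬ (∃ λ f → (∀ i j → i ℕ.< j → Asymmetric (w (f i)) (w (f j))) ⊎
                                  (∀ i j → i ℕ.< j → Asymmetric′ (w (f i)) (w (f j))))
      unstable w (f , inj₁ all) = stable (a ∘ w ∘ f , b ∘ w ∘ f , all)
      unstable w (f , inj₂ all) = stable (a ∘ w ∘ f , b′ ∘ w ∘ f , all)

  private
    B : ℝ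
    B = proj₁ (Compact⇒Bounded (K-compact ϕ))

    K-bound : ∀ {v} → K L ϕ v → Close B v 𝟘
    K-bound v∈K = proj₂ (Compact⇒Bounded (K-compact ϕ)) v∈K

    K-distance : ∀ v w → K L ϕ v → K L ϕ w → 𝔡 v w ≤ B + B
    K-distance v w v∈K w∈K = Close⇒𝔡≤ v w (Close-trans (K-bound v∈K) (Close-sym (K-bound w∈K)))

    someTuple : ∀ z → Tuple z
    someTuple = All.universal nonempty

  -- The value set belongs to the formula and is the same for all structures, so membership in the
  -- extension realizing `p` is what is wanted.
  value∈K : (p : S φ M) → ∀ b → K L ϕ (S.value p b)
  value∈K p b = K-respects ϕ (S.realizes p b) (eval∈K (S.N p) ϕ _)

  value⋆∈K : (q : S (φ ⋆) M) → ∀ a → K L ϕ (S.value q a)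
  value⋆∈K q a = K-respects ϕ (S.realizes q a) (eval∈K (S.N q) ϕ _)

  𝔡≤diam : ∀ a a′ b b′ → 𝔡 (φ M a b) (φ M a′ b′) ≤ diam φ M
  𝔡≤diam a a′ b b′ = sup-upper (_ , a , a′ , b , b′ , refl)
    (B + B , λ { (a , a′ , b , b′ , r≈) → ≤.≤-respˡ-≈ (sym r≈)
      (K-distance _ _ (eval∈K M ϕ (++⁺ a b)) (eval∈K M ϕ (++⁺ a′ b′))) })
    (a , a′ , b , b′ , refl)

  0≤diam : 0# ≤ diam φ M
  0≤diam = let a = someTuple x ; b = someTuple y in
    ≤.trans (𝔡-nonneg (φ M a b) (φ M a b)) (𝔡≤diam a a b b)

  𝔡≤typeDist : ∀ q q′ a → 𝔡 (S.value q a) (S.value q′ a) ≤ typeDist (φ ⋆) M q q′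
  𝔡≤typeDist q q′ a = sup-upper (_ , a , refl)
    (B + B , λ { (a , r≈) → ≤.≤-respˡ-≈ (sym r≈)
      (K-distance _ _ (value⋆∈K q a) (value⋆∈K q′ a)) })
    (a , refl)

  0≤typeDist : ∀ q q′ → 0# ≤ typeDist (φ ⋆) M q q′
  0≤typeDist q q′ = let a = someTuple x in
    ≤.trans (𝔡-nonneg (S.value q a) (S.value q′ a)) (𝔡≤typeDist q q′ a)

  module _ (p : S φ M) where

    -- `diam` ranges over points of `M`, whereas `p` is realized in an extension. One `a` in `M`
    -- imitates `p` at `b` and `b′` simultaneously, and its error can be made arbitrarily small.
    value-oscillation : ∀ b b′ → Close (diam φ M) (S.value p b) (S.value p b′)
    value-oscillation b b′ = Close-approx λ η 0<η →
      let (h , 0<h , h+h≈η) = halve 0<η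
          (a , close) = finitelySatisfiable ϕ p (b Vector.∷ b′ Vector.∷ Vector.[]) 0<h
      in Close-mono (≤.reflexive (trans (x∙yz≈y∙xz h (diam φ M) h) (+-congˡ h+h≈η)))
           (Close-trans (Close-sym (close zero))
             (Close-trans (𝔡≤⇒Close _ _ (𝔡≤diam a a b b′)) (close (suc zero))))

    module _ {ε γ δ} (0<ε : 0# < ε) (stable : Stable φ M ε) (0<δ : 0# < δ) (δ<γ : δ < γ) where

      private
        as : List (Tuple x)
        as = proj₁ (determined p stable δ<γ)

        -- The prescribed value at the point `(φ(aᵢ,b))ᵢ` is `φ(p,b)`. With this slope the penalty
        -- at distance `δ` equals `diam φ M`, the bound of `value-oscillation`.
        open McShaneExtension.Extension em R (someTuple y) (λ b i → φ M (lookup as i) b) (S.value p)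
          (λ b → K-bound (value∈K p b)) (0≤/ 0≤diam 0<δ)

        0≤error : 0# ≤ 2# * ε + γ
        0≤error = ≤.trans (*-nonneg (proj₁ (0<1+r 0≤1)) (proj₁ 0<ε))
          (r≤r+s (≤.trans (proj₁ 0<δ) (proj₁ δ<γ)))

      definition : FormulaOver (φ ⋆) M
      definition = record
        { connective = extension
        ; continuous = extension-continuous
        ; parameter  = lookup as
        }

      definition-approximates : ∀ b →
        𝔡 (FormulaOver.atPoint definition b) (S.value p b) ≤ 2# * ε + γ
      definition-approximates b = Close⇒𝔡≤ _ _ (extension-interpolates 0≤error
        (λ b b′ → Close-mono (≤.reflexive (sym (r/s*s≈r _ 0<δ))) (value-oscillation b b′))
        (λ b b′ close → proj₂ (determined p stable δ<γ) b b′
          (≡.subst (All _) (tabulate-lookup as) (tabulate⁺ close)))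
        b)

      -- The type metric is a supremum over all of `Mˣ`, so it dominates the distance of the values
      -- at each of the finitely many parameters.
      definition-lipschitz : ∀ q q′ →
        𝔡 (FormulaOver.atType definition q) (FormulaOver.atType definition q′)
          ≤ diam φ M / δ * typeDist (φ ⋆) M q q′
      definition-lipschitz q q′ = extension-lipschitz
        (S.value q ∘ lookup as) (S.value q′ ∘ lookup as) (0≤typeDist q q′)
        λ i → 𝔡≤typeDist q q′ (lookup as i)

corollary3p6 : ∀ {ℓ} → ExcludedMiddle ℓ →
    (R : CompleteOrderedField ℓ) (copy : ValueSpace.IsometricCopy R) →
    let open CompleteOrderedField R
        open ValueSpace R using (𝔡)
        open ContinuousLogic R copy in
    (L : Language) (M : Structure L)
    (x y : List (Language.Sort L)) (ϕ : Formula L (x ++ y)) →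
    let φ : Bivariate x y
        φ = ⟦ ϕ ⟧ in
    ∀ ε → 0# < ε → Stable φ M ε →
    ∀ γ δ → 0# < δ → δ < γ →
    (p : S φ M) →
    Σ (FormulaOver (φ ⋆) M) λ ψ →
      (∀ b → 𝔡 (FormulaOver.atPoint ψ b) (S.value p b) ≤ 2# * ε + γ) ×
      (∀ q q′ → 𝔡 (FormulaOver.atType ψ q) (FormulaOver.atType ψ q′)
                  ≤ diam φ M / δ * typeDist (φ ⋆) M q q′)
corollary3p6 em R copy L M x y ϕ ε 0<ε stable γ δ 0<δ δ<γ p =
  definition p 0<ε stable 0<δ δ<γ ,
  definition-approximates p 0<ε stable 0<δ δ<γ ,
  definition-lipschitz p 0<ε stable 0<δ δ<γ
  where open Definability em R copy M {x} {y} ϕ
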